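{- Let $A\in SL(2,\mathbb Q)$ have trace $q$, let $p$ be an odd prime with $p\notin\mathcal D(q)$ such that all entries of $A$ have denominators not divisible by $p$, and let $\delta=q^2-4$. If $(\delta|p)\ne0$ then $A^{\frac{p-(\delta|p)}{2}}\equiv(q+2|p)\,I \pmod p$. If $(\delta|p)=0$ then $A^p\equiv\frac q2 I\equiv\pm I\pmod p$.
   Context: For a rational $q=a/b$ in lowest terms, $\mathcal D(q)$ is the set of prime divisors of $b$; congruences mod $p$ of rationals (or matrices of rationals) whose denominators are prime to $p$ mean equality of their images in $\mathbb F_p$. Legendre symbol of a rational $x=a/b$ (lowest terms) at an odd prime $p\nmid b$: $(x|p)=1$ if $ab$ is a nonzero quadratic residue mod $p$, $(x|p)=-1$ if $ab$ is a quadratic nonresidue mod $p$, and $(x|p)=0$ if $p\mid a$. -}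

module Defs where

open import Data.Nat as ℕ using (ℕ; zero; suc)
open import Data.Nat.Divisibility using (_∣_; _∣?_)
open import Data.Integer as ℤ using (ℤ; +_; ∣_∣)
open import Data.Rational as ℚ using (ℚ; ↥_; ↧ₙ_; 0ℚ; 1ℚ)
open import Data.Fin using (Fin; zero; suc)
open import Data.List using (upTo)
open import Data.List.Relation.Unary.Any using (any?)
open import Relation.Nullary using (does)
open import Data.Bool using (if_then_else_)
open import Relation.Binary.PropositionalEquality using (_≡_)

Mat2 : Set
Mat2 = Fin 2 → Fin 2 → ℚ

infixl 7 _⊗_
_⊗_ : Mat2 → Mat2 → Mat2
(A ⊗ B) i j = A i zero ℚ.* B zero j ℚ.+ A i (suc zero) ℚ.* B (suc zero) j

scal : ℚ → Mat2
scal c zero zero = c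
scal c (suc zero) (suc zero) = c
scal c zero (suc zero) = 0ℚ
scal c (suc zero) zero = 0ℚ

I₂ : Mat2
I₂ = scal 1ℚ

infixr 8 _^ᴹ_
_^ᴹ_ : Mat2 → ℕ → Mat2
A ^ᴹ zero = I₂
A ^ᴹ suc n = A ⊗ (A ^ᴹ n)

det : Mat2 → ℚ
det A = A zero zero ℚ.* A (suc zero) (suc zero) ℚ.- A zero (suc zero) ℚ.* A (suc zero) zero

tr : Mat2 → ℚ
tr A = A zero zero ℚ.+ A (suc zero) (suc zero)

_∈𝒟_ : ℕ → ℚ → Set
p ∈𝒟 x = p ∣ ↧ₙ x

-- congruence mod p of rationals with denominators prime to p:
-- x ≡ y (mod p) iff p divides the reduced numerator of x - y
-- (equivalently, x and y have the same image in 𝔽_p).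
infix 4 _≡_[modℚ_]
_≡_[modℚ_] : ℚ → ℚ → ℕ → Set
x ≡ y [modℚ p ] = p ∣ ∣ ↥ (x ℚ.- y) ∣

infix 4 _≡ᴹ_[mod_]
_≡ᴹ_[mod_] : Mat2 → Mat2 → ℕ → Set
A ≡ᴹ B [mod p ] = ∀ i j → A i j ≡ B i j [modℚ p ]

isSquareMod : ℕ → ℤ → Set
isSquareMod p z = Data.List.Relation.Unary.Any.Any
  (λ t → p ∣ ∣ (+ t) ℤ.* (+ t) ℤ.- z ∣) (upTo p)

-- Legendre symbol (x|p) of a rational x = a/b (lowest terms), p ∤ b:
-- 0 if p ∣ a; 1 if ab is a (nonzero) square mod p; -1 otherwise.
legendre : ℚ → ℕ → ℤ
legendre x p =
  if does (p ∣? ∣ ↥ x ∣) then + 0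
  else if does (any? (λ t → p ∣? ∣ (+ t) ℤ.* (+ t) ℤ.- (↥ x ℤ.* + (↧ₙ x)) ∣) (upTo p))
       then + 1 else ℤ.-[1+ 0 ]

ℤ→ℚ : ℤ → ℚ
ℤ→ℚ z = z ℚ./ 1

{-# OPTIONS --safe #-}

-- Modulo p the matrix A satisfies X² = τ X − 1, where τ is the residue of q,
-- so its powers are computed in the ring 𝔽ₚ[X] / (X² − τ X + 1), where
-- X̄ = τ − X is the inverse of X. With w = X − X̄ one has w² = δ and
-- 2 X = q + w, so the Frobenius map and Euler's criterion give
-- 2 Xᵖ = q + (δ|p) w, that is, Xᵖ = X, X̄ or q / 2 according to (δ|p).
-- The exponent is then halved by means of (1 + X)² = (q + 2) X: the two
-- evaluations 1 + Xᵖ = (1 + X)ᵖ = (1 + X) ((q + 2) X)^((p − 1) / 2), multiplied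
-- by 1 + X, determine X^((p − (δ|p)) / 2) because
-- (q + 2)^((p − 1) / 2) = (q + 2|p).
module Submission where

open import Defs
open import Data.Nat using (ℕ; _/_)
open import Data.Nat.Primality using (Prime)
open import Data.Nat.Divisibility using (_∣_)
open import Data.Integer as ℤ using (ℤ; +_; ∣_∣)
open import Data.Rational as ℚ using (ℚ; ½; 1ℚ)
open import Data.Fin using (Fin)
open import Data.Product using (_×_)
open import Data.Sum using (_⊎_)
open import Relation.Nullary using (¬_)
open import Relation.Binary.PropositionalEquality using (_≡_; _≢_)
open import Level using (0ℓ)
open import Algebra.Bundles using (CommutativeRing; AbelianGroup)
open import Algebra.Morphism.Structures using (module RingMorphisms)
import Algebra.Construct.DirectProduct as DirectProduct
import Algebra.Properties.CommutativeSemiring.Binomial as Binomial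
import Algebra.Properties.CommutativeSemiring.Exp as CommutativeExp
import Algebra.Properties.Ring as RingProperties
import Algebra.Properties.Semiring.Exp as Exp
import Algebra.Properties.Semiring.Mult as Mult
import Algebra.Properties.Semiring.Sum as Sum
import Algebra.Solver.Ring.NaturalCoefficients.Default as Solver
open import Data.Fin as Fin using (toℕ; fromℕ; inject₁)
open import Data.Fin.Patterns using (0F; 1F)
import Data.Fin.Properties as Fin
open import Data.Integer using (-[1+_]; 0ℤ; 1ℤ; -1ℤ)
import Data.Integer.Divisibility.Signed as ℤ
import Data.Integer.Properties as ℤ
import Data.Integer.Tactic.RingSolver as ℤ-Solver
open import Data.List using (upTo)
open import Data.List.Membership.Propositional using (lose)
open import Data.List.Membership.Propositional.Properties using (∈-upTo⁺)
open import Data.List.Relation.Unary.Any using (any?; satisfied)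
open import Data.Nat as ℕ using (zero; suc; _!; _%_)
open import Data.Nat.Combinatorics using (_C_; nCk≡n!/k![n-k]!; k![n∸k]!∣n!; nCn≡1)
import Data.Nat.Coprimality as Coprimality
import Data.Nat.Divisibility as ℕ
import Data.Nat.DivMod as ℕ
open import Data.Nat.Primality using (euclidsLemma; prime⇒nonTrivial; ¬prime[0]; ¬prime[1])
import Data.Nat.Properties as ℕ
import Data.Nat.Tactic.RingSolver as ℕ-Solver
open import Data.Product using (∃; _,_; proj₁; proj₂)
open import Data.Rational using (mkℚ; ↥_; ↧_; ↧ₙ_)
import Data.Rational.Properties as ℚ
open import Data.Rational.Unnormalised using (mkℚᵘ; *≡*)
open import Data.Sum as Sum⊎ using (inj₁; inj₂)
open import Data.Vec using (Vec; []; _∷_; replicate)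
open import Relation.Nullary using (contradiction; yes; no)
open import Relation.Binary.PropositionalEquality as ≡ using (cong; subst)

-- The Frobenius map needs a commutative ring killed by p, which the 2 × 2 matrices over 𝔽ₚ do not
-- form. The quotient ring is one, and it allows a uniform computation of Xᵖ that never chooses
-- eigenvalues. Identities are carried only from this ring to the matrices, so it does no harm that
-- different classes give the same matrix when A is scalar modulo p. The factor q + 2 is the norm (1
-- + X)(1 + X̄). The relation (1 + X)² = (q + 2) X says that X is a square up to this factor, which
-- is why a symbol of q + 2 appears when the exponent is halved. Since δ = (q - 2)(q + 2), the
-- factor is invertible as soon as δ is.

-- Binomial coefficients modulo a prime, and the Frobenius map

prime∤! : ∀ {p} → Prime p → ∀ {k} → k ℕ.< p → ¬ (p ∣ k !)
prime∤! pr {zero} _ p∣1 = ℕ.<⇒≱ (ℕ.nonTrivial⇒n>1 _ {{prime⇒nonTrivial pr}}) (ℕ.∣⇒≤ p∣1)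
prime∤! pr {suc k} k<p p∣ with euclidsLemma (suc k) (k !) pr p∣
... | inj₁ h = ℕ.<⇒≱ k<p (ℕ.∣⇒≤ h)
... | inj₂ h = prime∤! pr (ℕ.<-trans (ℕ.n<1+n k) k<p) h

-- The product of `p C k` with `k !` and `(p ∸ k) !` is `p !`, which p divides, while both
-- factorials have only factors below p.
prime∣C : ∀ {p} → Prime p → ∀ {k} → 0 ℕ.< k → k ℕ.< p → p ∣ p C k
prime∣C {p} pr {k} 0<k k<p with euclidsLemma (p C k) (k ! ℕ.* (p ℕ.∸ k) !) pr p∣C*!!
  where
  instance _ = ℕ._!*_!≢0 k (p ℕ.∸ k)
  C*!!≡p! : (p C k) ℕ.* (k ! ℕ.* (p ℕ.∸ k) !) ≡ p !
  C*!!≡p! = ≡.trans (cong (ℕ._* (k ! ℕ.* (p ℕ.∸ k) !)) (nCk≡n!/k![n-k]! (ℕ.<⇒≤ k<p)))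
                    (ℕ.m/n*n≡m (k![n∸k]!∣n! (ℕ.<⇒≤ k<p)))
  n∣n! : ∀ n → 0 ℕ.< n → n ∣ n !
  n∣n! (suc n) _ = ℕ.m∣m*n (n !)
  p∣C*!! : p ∣ (p C k) ℕ.* (k ! ℕ.* (p ℕ.∸ k) !)
  p∣C*!! = subst (p ∣_) (≡.sym C*!!≡p!) (n∣n! p (ℕ.<-trans 0<k k<p))
... | inj₁ h = h
... | inj₂ h with euclidsLemma (k !) ((p ℕ.∸ k) !) pr h
...   | inj₁ p∣k! = contradiction p∣k! (prime∤! pr k<p)
...   | inj₂ p∣[p-k]! = contradiction p∣[p-k]! (prime∤! pr (ℕ.∸-monoʳ-< 0<k (ℕ.<⇒≤ k<p)))

-- Says only that the characteristic divides n. This is all that the Frobenius map uses, and a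
-- quadratic extension inherits it coordinate by coordinate.
_annihilates_ : ∀ {a ℓ} → ℕ → CommutativeRing a ℓ → Set _
n annihilates R = ∀ x → n · x ≈ 0#
  where
  open CommutativeRing R
  open Mult semiring using () renaming (_×_ to _·_)

module Frobenius {a ℓ} (R : CommutativeRing a ℓ) {p : ℕ} (pr : Prime p) (char : p annihilates R) where

  open CommutativeRing R
  open Mult semiring renaming (_×_ to _·_)
  open Exp semiring
  open Sum semiring
  open Binomial commutativeSemiring
  open import Relation.Binary.Reasoning.Setoid setoid

  ∣⇒×≈0 : ∀ {n} → p ∣ n → ∀ x → n · x ≈ 0#
  ∣⇒×≈0 {n} (ℕ.divides c n≡c*p) x = begin
    n · x             ≈⟨ ×-congˡ (≡.trans n≡c*p (ℕ.*-comm c p)) ⟩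
    (p ℕ.* c) · x     ≈⟨ ×-assocˡ x p c ⟨
    p · (c · x)       ≈⟨ char (c · x) ⟩
    0#                ∎

  private
    -- The separate index n, tied to p by an equation, lets p be split as a successor. This exposes
    -- the two outer terms of the sum; every inner one carries a coefficient divisible by p.
    expansion : ∀ n x y → n ≡ p → binomialExpansion x y n ≈ x ^ n + y ^ n
    expansion zero    x y ≡.refl = contradiction pr ¬prime[0]
    expansion (suc n) x y ≡.refl = begin
      binomialTerm x y p Fin.zero + sum rest
        ≈⟨ +-cong (trans (×-homo-1 _) (*-identityˡ _)) (sum-init-last rest) ⟩
      y ^ p + (∑[ i < n ] rest (inject₁ i) + rest (fromℕ n))
        ≈⟨ +-congˡ (+-cong (trans (sum-cong-≋ middle) (sum-replicate-zero n)) last) ⟩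
      y ^ p + (0# + x ^ p)
        ≈⟨ +-congˡ (+-identityˡ _) ⟩
      y ^ p + x ^ p
        ≈⟨ +-comm _ _ ⟩
      x ^ p + y ^ p ∎
      where
      rest : Fin (suc n) → Carrier
      rest i = binomialTerm x y p (Fin.suc i)
      middle : ∀ i → rest (inject₁ i) ≈ 0#
      middle i = ∣⇒×≈0 (prime∣C pr ℕ.z<s (ℕ.s<s i<n)) _
        where
        i<n : toℕ (inject₁ i) ℕ.< n
        i<n = subst (ℕ._< n) (≡.sym (Fin.toℕ-inject₁ i)) (Fin.toℕ<n i)
      last : rest (fromℕ n) ≈ x ^ p
      last = begin
        (p C suc (toℕ (fromℕ n))) · (x ^ suc (toℕ (fromℕ n)) * y ^ (n ℕ.∸ toℕ (fromℕ n)))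
          ≡⟨ cong (λ k → (p C suc k) · (x ^ suc k * y ^ (n ℕ.∸ k))) (Fin.toℕ-fromℕ n) ⟩
        (p C p) · (x ^ p * y ^ (n ℕ.∸ n))
          ≡⟨ ≡.cong₂ (λ j k → j · (x ^ p * y ^ k)) (nCn≡1 p) (ℕ.n∸n≡0 n) ⟩
        1 · (x ^ p * 1#)
          ≈⟨ ×-homo-1 _ ⟩
        x ^ p * 1#
          ≈⟨ *-identityʳ _ ⟩
        x ^ p ∎

  frobenius : ∀ x y → (x + y) ^ p ≈ x ^ p + y ^ p
  frobenius x y = trans (theorem p x y) (expansion p x y ≡.refl)

  1^n≈1 : ∀ n → 1# ^ n ≈ 1#
  1^n≈1 zero    = refl
  1^n≈1 (suc n) = trans (*-identityˡ _) (1^n≈1 n)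

-- Integers modulo n, and the residue field

infix 4 _≡_[mod_]

-- A record rather than a synonym, so that x and y can be inferred.
record _≡_[mod_] (x y : ℤ) (n : ℕ) : Set where
  constructor ∣⇒≡
  field ≡⇒∣ : + n ℤ.∣ x ℤ.- y
open _≡_[mod_]

ℤmod : ℕ → CommutativeRing 0ℓ 0ℓ
ℤmod n = record
  { Carrier = ℤ
  ; _≈_ = _≡_[mod n ]
  ; _+_ = ℤ._+_
  ; _*_ = ℤ._*_
  ; -_ = ℤ.-_
  ; 0# = 0ℤ
  ; 1# = 1ℤ
  ; isCommutativeRing = record
    { isRing = record
      { +-isAbelianGroup = record
        { isGroup = record
          { isMonoid = record
            { isSemigroup = record
              { isMagma = record
                { isEquivalence = record
                  { refl = exact ≡.refl
                  ; sym = λ {x} {y} x≡y → by (ℤ.∣m⇒∣-m (≡⇒∣ x≡y)) (negate x y)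
                  ; trans = λ {x} {y} {z} x≡y y≡z → by (ℤ.∣m∣n⇒∣m+n (≡⇒∣ x≡y) (≡⇒∣ y≡z)) (telescope x y z)
                  }
                ; ∙-cong = λ {x} {y} {u} {v} x≡y u≡v →
                    by (ℤ.∣m∣n⇒∣m+n (≡⇒∣ x≡y) (≡⇒∣ u≡v)) (add x y u v)
                }
              ; assoc = λ x y z → exact (ℤ.+-assoc x y z)
              }
            ; identity = (λ x → exact (ℤ.+-identityˡ x)) , (λ x → exact (ℤ.+-identityʳ x))
            }
          ; inverse = (λ x → exact (ℤ.+-inverseˡ x)) , (λ x → exact (ℤ.+-inverseʳ x))
          ; ⁻¹-cong = λ {x} {y} x≡y → by (ℤ.∣m⇒∣-m (≡⇒∣ x≡y)) (negate′ x y)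
          }
        ; comm = λ x y → exact (ℤ.+-comm x y)
        }
      ; *-cong = λ {x} {y} {u} {v} x≡y u≡v →
          by (ℤ.∣m∣n⇒∣m+n (ℤ.∣n⇒∣m*n u (≡⇒∣ x≡y)) (ℤ.∣n⇒∣m*n y (≡⇒∣ u≡v))) (mul x y u v)
      ; *-assoc = λ x y z → exact (ℤ.*-assoc x y z)
      ; *-identity = (λ x → exact (ℤ.*-identityˡ x)) , (λ x → exact (ℤ.*-identityʳ x))
      ; distrib = (λ x y z → exact (ℤ.*-distribˡ-+ x y z)) , (λ x y z → exact (ℤ.*-distribʳ-+ x y z))
      }
    ; *-comm = λ x y → exact (ℤ.*-comm x y)
    }
  }
  where
  by : ∀ {x y d} → + n ℤ.∣ d → d ≡ x ℤ.- y → x ≡ y [mod n ]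
  by h eq = ∣⇒≡ (subst (+ n ℤ.∣_) eq h)
  exact : ∀ {x y} → x ≡ y → x ≡ y [mod n ]
  exact {x} ≡.refl = ∣⇒≡ (ℤ.divides 0ℤ (ℤ.+-inverseʳ x))
  negate : ∀ x y → ℤ.- (x ℤ.- y) ≡ y ℤ.- x
  negate = ℤ-Solver.solve-∀
  telescope : ∀ x y z → (x ℤ.- y) ℤ.+ (y ℤ.- z) ≡ x ℤ.- z
  telescope = ℤ-Solver.solve-∀
  add : ∀ x y u v → (x ℤ.- y) ℤ.+ (u ℤ.- v) ≡ (x ℤ.+ u) ℤ.- (y ℤ.+ v)
  add = ℤ-Solver.solve-∀
  negate′ : ∀ x y → ℤ.- (x ℤ.- y) ≡ (ℤ.- x) ℤ.- (ℤ.- y)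
  negate′ = ℤ-Solver.solve-∀
  mul : ∀ x y u v → u ℤ.* (x ℤ.- y) ℤ.+ y ℤ.* (u ℤ.- v) ≡ x ℤ.* u ℤ.- y ℤ.* v
  mul = ℤ-Solver.solve-∀

-- The field 𝔽ₚ up to isomorphism. Working over an abstract one keeps integer
-- arithmetic from being unfolded, which would defeat inference.
record ResidueField (p : ℕ) : Set₁ where
  field
    commutativeRing : CommutativeRing 0ℓ 0ℓ
  open CommutativeRing commutativeRing public
  open RingMorphisms ℤ.+-*-rawRing rawRing using (IsRingHomomorphism)
  field
    ⟦_⟧            : ℤ → Carrier
    isHomomorphism : IsRingHomomorphism ⟦_⟧
    surjective     : ∀ x → ∃ λ z → x ≈ ⟦ z ⟧
    ∣⇒⟦⟧≈0         : ∀ {z} → p ℕ.∣ ∣ z ∣ → ⟦ z ⟧ ≈ 0#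
    ⟦⟧≈0⇒∣         : ∀ {z} → ⟦ z ⟧ ≈ 0# → p ℕ.∣ ∣ z ∣
  open IsRingHomomorphism isHomomorphism public using (+-homo; *-homo; -‿homo; 0#-homo; 1#-homo; ⟦⟧-cong)

residueField : ∀ p → ResidueField p
residueField p = record
  { commutativeRing = ℤmod p
  ; ⟦_⟧ = λ z → z
  ; isHomomorphism = record
    { isSemiringHomomorphism = record
      { isNearSemiringHomomorphism = record
        { +-isMonoidHomomorphism = record
          { isMagmaHomomorphism = record
            { isRelHomomorphism = record { cong = reflexive }
            ; homo = λ _ _ → refl
            }
          ; ε-homo = refl
          }
        ; *-homo = λ _ _ → refl
        }
      ; 1#-homo = refl
      }
    ; -‿homo = λ _ → refl
    }
  ; surjective = λ z → z , refl
  ; ∣⇒⟦⟧≈0 = λ {z} p∣z → ∣⇒≡ (subst (+ p ℤ.∣_) (≡.sym (ℤ.+-identityʳ z)) (ℤ.∣ᵤ⇒∣ p∣z))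
  ; ⟦⟧≈0⇒∣ = λ {z} z≈0 → ℤ.∣⇒∣ᵤ (subst (+ p ℤ.∣_) (ℤ.+-identityʳ z) (≡⇒∣ z≈0))
  }
  where open CommutativeRing (ℤmod p)

-- Integrality and Fermat's little theorem

module PrimeField {p : ℕ} (pr : Prime p) (F : ResidueField p) where

  open ResidueField F
  open Exp semiring
  open CommutativeExp commutativeSemiring using (^-distrib-*)
  open Mult semiring using (×-congʳ; ×-assoc-*) renaming (_×_ to _·_)
  open RingProperties ring
  open Solver commutativeSemiring using (solve; _:=_; _:+_; _:*_; con)
  open import Relation.Binary.Reasoning.Setoid setoid

  ∤⇒≉0 : ∀ {z} → ¬ (p ℕ.∣ ∣ z ∣) → ¬ (⟦ z ⟧ ≈ 0#)
  ∤⇒≉0 p∤z z≈0 = p∤z (⟦⟧≈0⇒∣ z≈0)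

  integral : ∀ {x y} → x * y ≈ 0# → x ≈ 0# ⊎ y ≈ 0#
  integral {x} {y} xy≈0 with surjective x | surjective y
  ... | a , x≈a | b , y≈b =
    Sum⊎.map (λ h → trans x≈a (∣⇒⟦⟧≈0 h)) (λ h → trans y≈b (∣⇒⟦⟧≈0 h))
      (euclidsLemma ∣ a ∣ ∣ b ∣ pr (subst (p ℕ.∣_) (ℤ.abs-* a b) (⟦⟧≈0⇒∣ ab≈0)))
    where
    ab≈0 : ⟦ a ℤ.* b ⟧ ≈ 0#
    ab≈0 = begin
      ⟦ a ℤ.* b ⟧       ≈⟨ *-homo a b ⟩
      ⟦ a ⟧ * ⟦ b ⟧     ≈⟨ *-cong x≈a y≈b ⟨
      x * y             ≈⟨ xy≈0 ⟩
      0#                ∎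

  1≉0 : ¬ (1# ≈ 0#)
  -- The number 1 enters as `0 !`, which p does not divide.
  1≉0 1≈0 = prime∤! pr {0} (ℕ.≤-trans ℕ.z<s (ℕ.nonTrivial⇒n>1 p {{prime⇒nonTrivial pr}}))
    (⟦⟧≈0⇒∣ (trans 1#-homo 1≈0))

  *-cancelˡ-≉0 : ∀ {x y z} → ¬ (x ≈ 0#) → x * y ≈ x * z → y ≈ z
  *-cancelˡ-≉0 {x} {y} {z} x≉0 xy≈xz
    with integral (trans (x[y-z]≈xy-xz x y z) (x≈y⇒x∙y⁻¹≈ε xy≈xz))
  ... | inj₁ x≈0 = contradiction x≈0 x≉0
  ... | inj₂ h   = x∙y⁻¹≈ε⇒x≈y y z h

  *-≉0 : ∀ {x y} → ¬ (x ≈ 0#) → ¬ (y ≈ 0#) → ¬ (x * y ≈ 0#)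
  *-≉0 x≉0 y≉0 xy≈0 = Sum⊎.[ x≉0 , y≉0 ] (integral xy≈0)

  ×1≈⟦⟧ : ∀ n → n · 1# ≈ ⟦ + n ⟧
  ×1≈⟦⟧ zero    = sym 0#-homo
  ×1≈⟦⟧ (suc n) = trans (+-cong (sym 1#-homo) (×1≈⟦⟧ n)) (sym (+-homo 1ℤ (+ n)))

  char : p annihilates commutativeRing
  char x = begin
    p · x            ≈⟨ ×-congʳ p (*-identityˡ x) ⟨
    p · (1# * x)     ≈⟨ ×-assoc-* p 1# x ⟨
    (p · 1#) * x     ≈⟨ *-congʳ (×1≈⟦⟧ p) ⟩
    ⟦ + p ⟧ * x      ≈⟨ *-congʳ (∣⇒⟦⟧≈0 ℕ.∣-refl) ⟩
    0# * x           ≈⟨ zeroˡ x ⟩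
    0#               ∎

  open Frobenius commutativeRing pr char

  0^[1+n]≈0 : ∀ n → 0# ^ suc n ≈ 0#
  0^[1+n]≈0 n = zeroˡ _

  0^p≈0 : 0# ^ p ≈ 0#
  0^p≈0 = subst (λ n → 0# ^ n ≈ 0#) (ℕ.suc-pred p) (0^[1+n]≈0 (ℕ.pred p))
    where instance _ = ℕ.nonTrivial⇒nonZero p {{prime⇒nonTrivial pr}}

  -- Induction on n: the Frobenius map turns (1 + n)ᵖ into 1 + nᵖ.
  fermat-+ : ∀ n → ⟦ + n ⟧ ^ p ≈ ⟦ + n ⟧
  fermat-+ zero    = trans (^-congˡ p 0#-homo) (trans 0^p≈0 (sym 0#-homo))
  fermat-+ (suc n) = begin
    ⟦ + suc n ⟧ ^ p              ≈⟨ ^-congˡ p step ⟩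
    (1# + ⟦ + n ⟧) ^ p           ≈⟨ frobenius 1# ⟦ + n ⟧ ⟩
    1# ^ p + ⟦ + n ⟧ ^ p         ≈⟨ +-cong (1^n≈1 p) (fermat-+ n) ⟩
    1# + ⟦ + n ⟧                 ≈⟨ step ⟨
    ⟦ + suc n ⟧                  ∎
    where
    step : ⟦ + suc n ⟧ ≈ 1# + ⟦ + n ⟧
    step = trans (+-homo 1ℤ (+ n)) (+-congʳ 1#-homo)

  -- Additivity of the p-th power, applied to -x + x = 0, makes (-x)ᵖ the negative of xᵖ without
  -- asking for the parity of p.
  fermat-neg : ∀ {x} → x ^ p ≈ x → (- x) ^ p ≈ - x
  fermat-neg {x} x^p≈x = trans (+-inverseˡ-unique _ _ (begin
    (- x) ^ p + x ^ p    ≈⟨ frobenius (- x) x ⟨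
    (- x + x) ^ p        ≈⟨ ^-congˡ p (-‿inverseˡ x) ⟩
    0# ^ p               ≈⟨ 0^p≈0 ⟩
    0#                   ∎)) (-‿cong x^p≈x)

  fermat : ∀ x → x ^ p ≈ x
  fermat x with surjective x
  ... | + n , x≈n = trans (^-congˡ p x≈n) (trans (fermat-+ n) (sym x≈n))
  ... | -[1+ n ] , x≈-n = begin
    x ^ p                   ≈⟨ ^-congˡ p x≈-[1+n] ⟩
    (- ⟦ + suc n ⟧) ^ p     ≈⟨ fermat-neg (fermat-+ (suc n)) ⟩
    - ⟦ + suc n ⟧           ≈⟨ x≈-[1+n] ⟨
    x                       ∎
    where
    x≈-[1+n] : x ≈ - ⟦ + suc n ⟧
    x≈-[1+n] = trans x≈-n (-‿homo (+ suc n))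

  -- Roots of monic polynomials over the prime field

  -- The coefficients c₀ , … , cₙ₋₁ stand for the monic polynomial
  -- c₀ + c₁ t + … + cₙ₋₁ tⁿ⁻¹ + tⁿ.
  eval : ∀ {n} → Vec Carrier n → Carrier → Carrier
  eval []       t = 1#
  eval (c ∷ cs) t = c + t * eval cs t

  -- Synthetic division by t - r: the coefficients of the quotient are the intermediate values of
  -- Horner's scheme at r.
  quotient : ∀ {n} → Carrier → Vec Carrier (suc n) → Vec Carrier n
  quotient r (c ∷ [])      = []
  quotient r (c ∷ d ∷ ds) = eval (d ∷ ds) r ∷ quotient r (d ∷ ds)

  -- f(t) − f(r) = (t − r) g(t), with the subtractions moved across so that
  -- it is a semiring identity.
  eval-quotient : ∀ {n} r (cs : Vec Carrier (suc n)) t →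
    eval cs t + r * eval (quotient r cs) t ≈ eval cs r + t * eval (quotient r cs) t
  eval-quotient r (c ∷ []) t =
    solve 3 (λ c r t → (c :+ t :* con 1) :+ r :* con 1 := (c :+ r :* con 1) :+ t :* con 1) refl c r t
  eval-quotient r (c ∷ cs@(_ ∷ _)) t = begin
    (c + t * f t) + r * (f r + t * g t)
      ≈⟨ solve 6 (λ c t r x y z → (c :+ t :* x) :+ r :* (y :+ t :* z)
           := (c :+ r :* y) :+ t :* (x :+ r :* z)) refl c t r (f t) (f r) (g t) ⟩
    (c + r * f r) + t * (f t + r * g t)
      ≈⟨ +-congˡ (*-congˡ (eval-quotient r cs t)) ⟩
    (c + r * f r) + t * (f r + t * g t) ∎
    where
    f g : Carrier → Carrier
    f = eval cs
    g = eval (quotient r cs)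

  -- With both values of f zero, `eval-quotient` becomes r g(t) = t g(t), so (t - r) g(t) = 0 and
  -- integrality decides.
  root-or-quotient-root : ∀ {n} (cs : Vec Carrier (suc n)) {r t} →
    eval cs r ≈ 0# → eval cs t ≈ 0# → t ≈ r ⊎ eval (quotient r cs) t ≈ 0#
  root-or-quotient-root cs {r} {t} fr≈0 ft≈0 =
    Sum⊎.map₁ (x∙y⁻¹≈ε⇒x≈y t r)
      (integral (trans ([y-z]x≈yx-zx _ _ _) (x≈y⇒x∙y⁻¹≈ε tg≈rg)))
    where
    g : Carrier → Carrier
    g = eval (quotient r cs)
    tg≈rg : t * g t ≈ r * g t
    tg≈rg = begin
      t * g t                ≈⟨ +-identityˡ _ ⟨
      0# + t * g t           ≈⟨ +-congʳ fr≈0 ⟨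
      eval cs r + t * g t    ≈⟨ eval-quotient r cs t ⟨
      eval cs t + r * g t    ≈⟨ +-congʳ ft≈0 ⟩
      0# + r * g t           ≈⟨ +-identityˡ _ ⟩
      r * g t                ∎

  -- Induction on the degree: after division by t minus the last listed root, the other listed
  -- roots, being distinct from it, are roots of the quotient. In degree 0 the polynomial is the
  -- constant 1, which has no root.
  roots-exhaust : ∀ {n} (cs : Vec Carrier n) (r : ℕ → Carrier) →
    (∀ {k} → k ℕ.< n → eval cs (r k) ≈ 0#) →
    (∀ {j k} → j ℕ.< k → k ℕ.< n → ¬ (r j ≈ r k)) →
    ∀ {a} → eval cs a ≈ 0# → ∃ λ k → k ℕ.< n × a ≈ r k
  roots-exhaust {zero}  []  r root distinct 1≈0 = contradiction 1≈0 1≉0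
  roots-exhaust {suc n} cs r root distinct fa≈0
    with root-or-quotient-root cs (root (ℕ.n<1+n n)) fa≈0
  ... | inj₁ a≈r  = n , ℕ.n<1+n n , a≈r
  ... | inj₂ ga≈0
    with roots-exhaust (quotient (r n) cs) r root′ (λ j<k k<n → distinct j<k (ℕ.m<n⇒m<1+n k<n)) ga≈0
    where
    root′ : ∀ {k} → k ℕ.< n → eval (quotient (r n) cs) (r k) ≈ 0#
    root′ k<n with root-or-quotient-root cs (root (ℕ.n<1+n n)) (root (ℕ.m<n⇒m<1+n k<n))
    ... | inj₁ rk≈rn = contradiction rk≈rn (distinct k<n (ℕ.n<1+n n))
    ... | inj₂ h     = h
  ... | k , k<n , a≈rk = k , ℕ.m<n⇒m<1+n k<n , a≈rk

  *≈1⇒±1 : ∀ {y} → y * y ≈ 1# → y ≈ 1# ⊎ y ≈ - 1#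
  *≈1⇒±1 {y} y²≈1 = Sum⊎.map (x∙y⁻¹≈ε⇒x≈y y 1#) (+-inverseˡ-unique y 1#) (integral product≈0)
    where
    product≈0 : (y - 1#) * (y + 1#) ≈ 0#
    product≈0 = begin
      (y - 1#) * (y + 1#)                  ≈⟨ solve 2 (λ y n → (y :+ n) :* (y :+ con 1) := y :* y :+ n :+ y :* (con 1 :+ n)) refl y (- 1#) ⟩
      y * y - 1# + y * (1# - 1#)           ≈⟨ +-cong (trans (+-congʳ y²≈1) (-‿inverseʳ 1#)) (trans (*-congˡ (-‿inverseʳ 1#)) (zeroʳ y)) ⟩
      0# + 0#                              ≈⟨ +-identityˡ 0# ⟩
      0#                                   ∎

  -- Squares modulo an odd prime

  module Odd {n : ℕ} (p≡1+m+m : p ≡ suc (suc n ℕ.+ suc n)) where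

    -- This is (p - 1) / 2, kept as a successor so that 0ᵐ = 0 and the polynomial tᵐ - 1 has
    -- positive degree.
    m : ℕ
    m = suc n

    ≉0⇒^[m+m]≈1 : ∀ {x} → ¬ (x ≈ 0#) → x ^ (m ℕ.+ m) ≈ 1#
    ≉0⇒^[m+m]≈1 {x} x≉0 = *-cancelˡ-≉0 x≉0 (begin
      x ^ suc (m ℕ.+ m)     ≡⟨ cong (x ^_) p≡1+m+m ⟨
      x ^ p                 ≈⟨ fermat x ⟩
      x                     ≈⟨ *-identityʳ x ⟨
      x * 1#                ∎)

    [x*x]^m≈1 : ∀ {x} → ¬ (x ≈ 0#) → (x * x) ^ m ≈ 1#
    [x*x]^m≈1 {x} x≉0 = begin
      (x * x) ^ m        ≈⟨ ^-distrib-* x x m ⟩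
      x ^ m * x ^ m      ≈⟨ ^-homo-* x m m ⟨
      x ^ (m ℕ.+ m)      ≈⟨ ≉0⇒^[m+m]≈1 x≉0 ⟩
      1#                 ∎

    0^m≈0 : ∀ {x} → x ≈ 0# → x ^ m ≈ 0#
    0^m≈0 x≈0 = trans (^-congˡ m x≈0) (zeroˡ _)

    square : ℕ → Carrier
    square k = ⟦ + suc k ⟧ * ⟦ + suc k ⟧

    ⟦+⟧≉0 : ∀ {n} → 0 ℕ.< n → n ℕ.< p → ¬ (⟦ + n ⟧ ≈ 0#)
    ⟦+⟧≉0 0<n n<p n≈0 = ℕ.<⇒≱ n<p (ℕ.∣⇒≤ {{ℕ.>-nonZero 0<n}} (⟦⟧≈0⇒∣ n≈0))

    m+m<p : m ℕ.+ m ℕ.< p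
    m+m<p = subst (m ℕ.+ m ℕ.<_) (≡.sym p≡1+m+m) (ℕ.n<1+n (m ℕ.+ m))

    m<p : m ℕ.< p
    m<p = ℕ.≤-<-trans (ℕ.m≤m+n m m) m+m<p

    -- The difference of the two squares factors as the difference times the sum of `suc k` and
    -- `suc j`. Both factors lie strictly between 0 and p, hence are nonzero modulo p.
    squares-distinct : ∀ {j k} → j ℕ.< k → k ℕ.< m → ¬ (square j ≈ square k)
    squares-distinct {j} {k} j<k k<m j²≈k² =
      Sum⊎.[ ⟦+⟧≉0 ℕ.z<s (ℕ.<-trans d<m m<p) , ⟦+⟧≉0 ℕ.z<s s<p ] (integral ds≈0)
      where
      d : ℕ
      d = k ℕ.∸ suc j
      1+k≡1+j+1+d : suc k ≡ suc j ℕ.+ suc d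
      1+k≡1+j+1+d = cong suc (≡.sym (≡.trans (ℕ.+-suc j d) (ℕ.m+[n∸m]≡n j<k)))
      d<m : suc d ℕ.< m
      d<m = ℕ.≤-<-trans (subst (suc d ℕ.≤_) (ℕ.suc-injective (≡.sym 1+k≡1+j+1+d)) (ℕ.m≤n+m (suc d) j)) k<m
      s<p : suc j ℕ.+ suc k ℕ.< p
      s<p = ℕ.≤-<-trans (ℕ.+-mono-≤ (ℕ.≤-trans j<k (ℕ.<⇒≤ k<m)) k<m) m+m<p
      x y : Carrier
      x = ⟦ + suc j ⟧
      y = ⟦ + suc d ⟧
      k≈ : ⟦ + suc k ⟧ ≈ x + y
      k≈ = trans (⟦⟧-cong (cong +_ 1+k≡1+j+1+d)) (+-homo (+ suc j) (+ suc d))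
      ds≈0 : y * ⟦ + (suc j ℕ.+ suc k) ⟧ ≈ 0#
      ds≈0 = +-identityʳ-unique (x * x) _ (begin
        x * x + y * ⟦ + (suc j ℕ.+ suc k) ⟧
          ≈⟨ +-congˡ (*-congˡ (trans (+-homo (+ suc j) (+ suc k)) (+-congˡ k≈))) ⟩
        x * x + y * (x + (x + y))
          ≈⟨ solve 2 (λ x y → x :* x :+ y :* (x :+ (x :+ y)) := (x :+ y) :* (x :+ y)) refl x y ⟩
        (x + y) * (x + y)
          ≈⟨ *-cong k≈ k≈ ⟨
        square k
          ≈⟨ j²≈k² ⟨
        x * x ∎)

    -- The leading coefficient is implicit, which leaves -1 and m - 1 zeros.
    tᵐ-1 : Vec Carrier m
    tᵐ-1 = - 1# ∷ replicate n 0#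

    eval-tᵐ-1 : ∀ t → eval tᵐ-1 t ≈ - 1# + t ^ m
    eval-tᵐ-1 t = +-congˡ (*-congˡ (monomial n))
      where
      monomial : ∀ k → eval (replicate k 0#) t ≈ t ^ k
      monomial zero    = refl
      monomial (suc k) = trans (+-identityˡ _) (*-congˡ (monomial k))

    tᵐ-1-root : ∀ {t} → t ^ m ≈ 1# → eval tᵐ-1 t ≈ 0#
    tᵐ-1-root {t} t^m≈1 = trans (eval-tᵐ-1 t) (trans (+-congˡ t^m≈1) (-‿inverseˡ 1#))

    -- The hard half of Euler's criterion, by counting: 1², ..., m² are already m distinct roots of
    -- tᵐ - 1, so a is one of them.
    ^m≈1⇒square : ∀ {a} → a ^ m ≈ 1# → ∃ λ t → t ℕ.< p × a ≈ ⟦ + t ⟧ * ⟦ + t ⟧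
    ^m≈1⇒square {a} a^m≈1
      with roots-exhaust tᵐ-1 square
        (λ k<m → tᵐ-1-root ([x*x]^m≈1 (⟦+⟧≉0 ℕ.z<s (ℕ.≤-<-trans k<m m<p))))
        squares-distinct (tᵐ-1-root a^m≈1)
    ... | k , k<m , a≈k² = suc k , ℕ.≤-<-trans k<m m<p , a≈k²

    ^m≈±1 : ∀ {x} → ¬ (x ≈ 0#) → x ^ m ≈ 1# ⊎ x ^ m ≈ - 1#
    ^m≈±1 {x} x≉0 = *≈1⇒±1 (trans (sym (^-homo-* x m m)) (≉0⇒^[m+m]≈1 x≉0))

-- Quadratic extensions of a commutative ring

-- K[X] / (X² − q X − r); the pair (x , y) stands for x + y X.
module QuadraticExtension {a ℓ} (K : CommutativeRing a ℓ) (q r : CommutativeRing.Carrier K) where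

  private
    open module K = CommutativeRing K
    open Solver commutativeSemiring using (solve; _:=_; _:+_; _:*_; con)
    open module A = AbelianGroup (DirectProduct.abelianGroup +-abelianGroup +-abelianGroup)
      using () renaming (Carrier to Pair; _∙_ to _⊕_; _≈_ to _≋_)
    infixl 7 _⊛_
    _⊛_ : Pair → Pair → Pair
    (x , y) ⊛ (u , v) = x * u + r * (y * v) , x * v + y * u + q * (y * v)

    ⊛-comm : ∀ x y → x ⊛ y ≋ y ⊛ x
    ⊛-comm (x , y) (u , v) =
      solve 5 (λ r x y u v → x :* u :+ r :* (y :* v) := u :* x :+ r :* (v :* y)) K.refl r x y u v ,
      solve 5 (λ q x y u v → x :* v :+ y :* u :+ q :* (y :* v) := u :* y :+ v :* x :+ q :* (v :* y)) K.refl q x y u v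

    ⊛-assoc : ∀ x y z → (x ⊛ y) ⊛ z ≋ x ⊛ (y ⊛ z)
    ⊛-assoc (x , y) (u , v) (s , t) =
      solve 8 (λ q r x y u v s t →
        (x :* u :+ r :* (y :* v)) :* s :+ r :* ((x :* v :+ y :* u :+ q :* (y :* v)) :* t) :=
        x :* (u :* s :+ r :* (v :* t)) :+ r :* (y :* (u :* t :+ v :* s :+ q :* (v :* t))))
        K.refl q r x y u v s t ,
      solve 8 (λ q r x y u v s t →
        (x :* u :+ r :* (y :* v)) :* t :+ (x :* v :+ y :* u :+ q :* (y :* v)) :* s
          :+ q :* ((x :* v :+ y :* u :+ q :* (y :* v)) :* t) :=
        x :* (u :* t :+ v :* s :+ q :* (v :* t)) :+ y :* (u :* s :+ r :* (v :* t))
          :+ q :* (y :* (u :* t :+ v :* s :+ q :* (v :* t))))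
        K.refl q r x y u v s t

    ⊛-identityˡ : ∀ x → (1# , 0#) ⊛ x ≋ x
    ⊛-identityˡ (x , y) =
      solve 3 (λ r x y → con 1 :* x :+ r :* (con 0 :* y) := x) K.refl r x y ,
      solve 3 (λ q x y → con 1 :* y :+ con 0 :* x :+ q :* (con 0 :* y) := y) K.refl q x y

    ⊛-distribˡ : ∀ x y z → x ⊛ (y ⊕ z) ≋ (x ⊛ y) ⊕ (x ⊛ z)
    ⊛-distribˡ (x , y) (u , v) (s , t) =
      solve 7 (λ r x y u v s t → x :* (u :+ s) :+ r :* (y :* (v :+ t)) :=
        (x :* u :+ r :* (y :* v)) :+ (x :* s :+ r :* (y :* t))) K.refl r x y u v s t ,
      solve 7 (λ q x y u v s t → x :* (v :+ t) :+ y :* (u :+ s) :+ q :* (y :* (v :+ t)) :=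
        (x :* v :+ y :* u :+ q :* (y :* v)) :+ (x :* t :+ y :* s :+ q :* (y :* t))) K.refl q x y u v s t

    ⊛-cong : ∀ {x y u v} → x ≋ y → u ≋ v → x ⊛ u ≋ y ⊛ v
    ⊛-cong (e₁ , e₂) (f₁ , f₂) =
      +-cong (*-cong e₁ f₁) (*-congˡ (*-cong e₂ f₂)) ,
      +-cong (+-cong (*-cong e₁ f₂) (*-cong e₂ f₁)) (*-congˡ (*-cong e₂ f₂))

  commutativeRing : CommutativeRing a ℓ
  commutativeRing = record
    { _+_ = _⊕_
    ; _*_ = _⊛_
    ; 0#  = A.ε
    ; 1#  = 1# , 0#
    ; isCommutativeRing = record
      { isRing = record
        { +-isAbelianGroup = A.isAbelianGroup
        ; *-cong = ⊛-cong
        ; *-assoc = ⊛-assoc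
        ; *-identity = ⊛-identityˡ , λ x → A.trans (⊛-comm x _) (⊛-identityˡ x)
        ; distrib = ⊛-distribˡ , λ x y z → A.trans (⊛-comm (y ⊕ z) x)
            (A.trans (⊛-distribˡ x y z) (A.∙-cong (⊛-comm x y) (⊛-comm x z)))
        }
      ; *-comm = ⊛-comm
      }
    }

  private
    module R = CommutativeRing commutativeRing
    open Exp semiring
    module RExp = Exp R.semiring
    open Mult semiring using () renaming (_×_ to _·_)
    module RMult = Mult R.semiring renaming (_×_ to _·_)

  constant : Carrier → R.Carrier
  constant c = c , 0#

  X : R.Carrier
  X = 0# , 1#

  -- Multiples are taken coordinatewise. This makes the Frobenius map available in the extension.
  annihilates : ∀ {n} → n annihilates K → n annihilates commutativeRing
  annihilates {n} nK≈0 (x , y) = K.trans (proj-× n .proj₁) (nK≈0 x) , K.trans (proj-× n .proj₂) (nK≈0 y)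
    where
    proj-× : ∀ n → n RMult.· (x , y) R.≈ (n · x , n · y)
    proj-× zero    = R.refl
    proj-× (suc n) = R.+-congˡ (proj-× n)

  constant-cong : ∀ {c d} → c ≈ d → constant c R.≈ constant d
  constant-cong c≈d = c≈d , K.refl

  constant-+ : ∀ c d → constant (c + d) R.≈ constant c R.+ constant d
  constant-+ c d = K.refl , K.sym (+-identityˡ 0#)

  constant-* : ∀ c d → constant (c * d) R.≈ constant c R.* constant d
  constant-* c d =
    solve 3 (λ r c d → c :* d := c :* d :+ r :* (con 0 :* con 0)) K.refl r c d ,
    solve 3 (λ q c d → con 0 := c :* con 0 :+ con 0 :* d :+ q :* (con 0 :* con 0)) K.refl q c d

  constant-^ : ∀ c n → constant (c ^ n) R.≈ constant c RExp.^ n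
  constant-^ c zero    = R.refl
  constant-^ c (suc n) = R.trans (constant-* c (c ^ n)) (R.*-congˡ {constant c} (constant-^ c n))

-- Powers of an element of norm one, and the halved exponent

module Halving {a ℓ} (R : CommutativeRing a ℓ) {p : ℕ} (pr : Prime p) (char : p annihilates R)
  {m : ℕ} (p≡1+m+m : p ≡ suc (m ℕ.+ m)) where

  open CommutativeRing R
  open Exp semiring
  open CommutativeExp commutativeSemiring using (^-distrib-*)
  open Frobenius R pr char
  open Solver commutativeSemiring using (solve; _:=_; _:+_; _:*_; con)
  open import Relation.Binary.Reasoning.Setoid setoid

  -- Isolates the square of x. It serves for w, where w² is the scalar δ, and for 1 + X, whose
  -- square is a scalar multiple of X.
  ^p : ∀ x → x ^ p ≈ x * (x * x) ^ m
  ^p x = begin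
    x ^ p                    ≡⟨ cong (x ^_) p≡1+m+m ⟩
    x * x ^ (m ℕ.+ m)        ≈⟨ *-congˡ (^-homo-* x m m) ⟩
    x * (x ^ m * x ^ m)      ≈⟨ *-congˡ (^-distrib-* x x m) ⟨
    x * (x * x) ^ m          ∎

  -- The ring has zero divisors when δ is a square modulo p, so cancellation has to rest on an
  -- explicit inverse.
  unit-cancelˡ : ∀ {u v y z} → v * u ≈ 1# → u * y ≈ u * z → y ≈ z
  unit-cancelˡ {u} {v} {y} {z} vu≈1 uy≈uz = begin
    y              ≈⟨ *-identityˡ y ⟨
    1# * y         ≈⟨ *-congʳ vu≈1 ⟨
    v * u * y      ≈⟨ *-assoc v u y ⟩
    v * (u * y)    ≈⟨ *-congˡ uy≈uz ⟩
    v * (u * z)    ≈⟨ *-assoc v u z ⟨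
    v * u * z      ≈⟨ *-congʳ vu≈1 ⟩
    1# * z         ≈⟨ *-identityˡ z ⟩
    z              ∎

  -- w stands for X − X̄ and h for 1 / 2.
  module Conjugates {X X̄ w h : Carrier} (XX̄≈1 : X * X̄ ≈ 1#) (w+X̄≈X : w + X̄ ≈ X) (h+h≈1 : h + h ≈ 1#)
    (trace^p : (X + X̄) ^ p ≈ X + X̄) where

    private
      q s : Carrier
      q = X + X̄
      s = q + (1# + 1#)

    halve : ∀ {y z} → y + y ≈ z → y ≈ z * h
    halve {y} {z} y+y≈z = begin
      y                ≈⟨ *-identityʳ y ⟨
      y * 1#           ≈⟨ *-congˡ h+h≈1 ⟨
      y * (h + h)      ≈⟨ solve 2 (λ y h → y :* (h :+ h) := (y :+ y) :* h) refl y h ⟩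
      (y + y) * h      ≈⟨ *-congʳ y+y≈z ⟩
      z * h            ∎

    double-injective : ∀ {y z} → y + y ≈ z + z → y ≈ z
    double-injective y+y≈z+z = trans (halve y+y≈z+z) (sym (halve refl))

    q+w≈X+X : q + w ≈ X + X
    q+w≈X+X = begin
      X + X̄ + w       ≈⟨ solve 3 (λ x y w → x :+ y :+ w := x :+ (w :+ y)) refl X X̄ w ⟩
      X + (w + X̄)     ≈⟨ +-congˡ w+X̄≈X ⟩
      X + X           ∎

    -- The identity (X - X̄)² + 4 X X̄ = (X + X̄)², with X replaced by w + X̄ and each X X̄ by 1, so
    -- that no subtraction occurs.
    w*w+4≈q*q : w * w + (1# + 1# + 1# + 1#) ≈ q * q
    w*w+4≈q*q = begin
      w * w + (1# + 1# + 1# + 1#)                ≈⟨ +-congˡ (+-cong (+-cong (+-cong one one) one) one) ⟨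
      w * w + ((w + X̄) * X̄ + (w + X̄) * X̄ + (w + X̄) * X̄ + (w + X̄) * X̄)
        ≈⟨ solve 2 (λ w x → w :* w :+ ((w :+ x) :* x :+ (w :+ x) :* x :+ (w :+ x) :* x :+ (w :+ x) :* x)
             := (w :+ x :+ x) :* (w :+ x :+ x)) refl w X̄ ⟩
      (w + X̄ + X̄) * (w + X̄ + X̄)                  ≈⟨ *-cong (+-congʳ w+X̄≈X) (+-congʳ w+X̄≈X) ⟩
      q * q                                      ∎
      where
      one : (w + X̄) * X̄ ≈ 1#
      one = trans (*-congʳ w+X̄≈X) XX̄≈1

    -- Two evaluations of the p-th power of X + X = q + w. The trace q is fixed by hypothesis, so
    -- all that remains to be known is (w²)ᵐ.
    double-^p : X ^ p + X ^ p ≈ q + w * (w * w) ^ m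
    double-^p = begin
      X ^ p + X ^ p              ≈⟨ frobenius X X ⟨
      (X + X) ^ p                ≈⟨ ^-congˡ p q+w≈X+X ⟨
      (q + w) ^ p                ≈⟨ frobenius q w ⟩
      q ^ p + w ^ p              ≈⟨ +-cong trace^p (^p w) ⟩
      q + w * (w * w) ^ m        ∎

    split⇒X^p≈X : (w * w) ^ m ≈ 1# → X ^ p ≈ X
    split⇒X^p≈X split = double-injective (begin
      X ^ p + X ^ p              ≈⟨ double-^p ⟩
      q + w * (w * w) ^ m        ≈⟨ +-congˡ (trans (*-congˡ split) (*-identityʳ w)) ⟩
      q + w                      ≈⟨ q+w≈X+X ⟩
      X + X                      ∎)

    inert⇒X^p≈X̄ : (w * w) ^ m ≈ - 1# → X ^ p ≈ X̄
    inert⇒X^p≈X̄ inert = double-injective (begin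
      X ^ p + X ^ p              ≈⟨ double-^p ⟩
      q + w * (w * w) ^ m        ≈⟨ +-congˡ (*-congˡ inert) ⟩
      q + w * - 1#               ≈⟨ +-congʳ (+-congʳ w+X̄≈X) ⟨
      w + X̄ + X̄ + w * - 1#       ≈⟨ solve 3 (λ w x n → w :+ x :+ x :+ w :* n := x :+ x :+ w :* (con 1 :+ n)) refl w X̄ (- 1#) ⟩
      X̄ + X̄ + w * (1# - 1#)      ≈⟨ +-congˡ (trans (*-congˡ (-‿inverseʳ 1#)) (zeroʳ w)) ⟩
      X̄ + X̄ + 0#                 ≈⟨ +-identityʳ _ ⟩
      X̄ + X̄                      ∎)

    ramified⇒X^p≈q/2 : (w * w) ^ m ≈ 0# → X ^ p ≈ q * h
    ramified⇒X^p≈q/2 ramified = halve (begin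
      X ^ p + X ^ p              ≈⟨ double-^p ⟩
      q + w * (w * w) ^ m        ≈⟨ +-congˡ (trans (*-congˡ ramified) (zeroʳ w)) ⟩
      q + 0#                     ≈⟨ +-identityʳ q ⟩
      q                          ∎)

    [1+X]²≈sX : (1# + X) * (1# + X) ≈ s * X
    [1+X]²≈sX = begin
      (1# + X) * (1# + X)              ≈⟨ solve 1 (λ x → (con 1 :+ x) :* (con 1 :+ x) := con 1 :+ x :* x :+ x :+ x) refl X ⟩
      1# + X * X + X + X               ≈⟨ +-congʳ (+-congʳ (+-congʳ XX̄≈1)) ⟨
      X * X̄ + X * X + X + X            ≈⟨ solve 2 (λ x y → x :* y :+ x :* x :+ x :+ x := (x :+ y :+ con 2) :* x) refl X X̄ ⟩
      (X + X̄ + (1# + 1#)) * X          ∎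

    [1+X][1+X̄]≈s : (1# + X) * (1# + X̄) ≈ s
    [1+X][1+X̄]≈s = begin
      (1# + X) * (1# + X̄)              ≈⟨ solve 2 (λ x y → (con 1 :+ x) :* (con 1 :+ y) := con 1 :+ (x :+ y :+ x :* y)) refl X X̄ ⟩
      1# + (X + X̄ + X * X̄)             ≈⟨ +-congˡ (+-congˡ XX̄≈1) ⟩
      1# + (X + X̄ + 1#)                ≈⟨ solve 1 (λ y → con 1 :+ (y :+ con 1) := y :+ con 2) refl q ⟩
      q + (1# + 1#)                    ∎

    module Half {s⁻¹ : Carrier} (s⁻¹s≈1 : s⁻¹ * s ≈ 1#) (s^m*s^m≈1 : s ^ m * s ^ m ≈ 1#) where

      -- Since p is odd, (1 + X)ᵖ has one factor left over after pairing. The extra 1 + X completes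
      -- it to a square, and only powers of s and X remain.
      [1+X][1+X]^p : (1# + X) * (1# + X ^ p) ≈ s * (X * (s ^ m * X ^ m))
      [1+X][1+X]^p = begin
        (1# + X) * (1# + X ^ p)                   ≈⟨ *-congˡ (trans (frobenius 1# X) (+-congʳ (1^n≈1 p))) ⟨
        (1# + X) * (1# + X) ^ p                   ≈⟨ *-congˡ (^p (1# + X)) ⟩
        (1# + X) * ((1# + X) * ((1# + X) * (1# + X)) ^ m)
                                                  ≈⟨ *-assoc _ _ _ ⟨
        (1# + X) * (1# + X) * ((1# + X) * (1# + X)) ^ m
                                                  ≈⟨ *-cong [1+X]²≈sX (^-congˡ m [1+X]²≈sX) ⟩
        s * X * (s * X) ^ m                       ≈⟨ *-assoc _ _ _ ⟩
        s * (X * (s * X) ^ m)                     ≈⟨ *-congˡ (*-congˡ (^-distrib-* s X m)) ⟩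
        s * (X * (s ^ m * X ^ m))                 ∎

      -- Here the left side of `[1+X][1+X]^p` is (1 + X)² = s X. Cancelling s and X leaves sᵐ Xᵐ =
      -- 1, and sᵐ is its own inverse.
      split⇒X^m≈s^m : X ^ p ≈ X → X ^ m ≈ s ^ m
      split⇒X^m≈s^m X^p≈X = unit-cancelˡ s^m*s^m≈1 (trans (unit-cancelˡ X̄X≈1 (unit-cancelˡ s⁻¹s≈1 (begin
        s * (X * (s ^ m * X ^ m))       ≈⟨ [1+X][1+X]^p ⟨
        (1# + X) * (1# + X ^ p)         ≈⟨ *-congˡ (+-congˡ X^p≈X) ⟩
        (1# + X) * (1# + X)             ≈⟨ [1+X]²≈sX ⟩
        s * X                           ≈⟨ *-congˡ (*-identityʳ X) ⟨
        s * (X * 1#)                    ∎))) (sym s^m*s^m≈1))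
        where
        X̄X≈1 : X̄ * X ≈ 1#
        X̄X≈1 = trans (*-comm X̄ X) XX̄≈1

      -- Here the left side is the norm s of 1 + X. The factor X on the right is not cancelled but
      -- joins Xᵐ, which accounts for the exponent m + 1.
      inert⇒X^[1+m]≈s^m : X ^ p ≈ X̄ → X ^ suc m ≈ s ^ m
      inert⇒X^[1+m]≈s^m X^p≈X̄ = unit-cancelˡ s^m*s^m≈1 (trans (unit-cancelˡ s⁻¹s≈1 (begin
        s * (s ^ m * (X * X ^ m))       ≈⟨ *-congˡ (solve 3 (λ t x y → t :* (x :* y) := x :* (t :* y)) refl (s ^ m) X (X ^ m)) ⟩
        s * (X * (s ^ m * X ^ m))       ≈⟨ [1+X][1+X]^p ⟨
        (1# + X) * (1# + X ^ p)         ≈⟨ *-congˡ (+-congˡ X^p≈X̄) ⟩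
        (1# + X) * (1# + X̄)             ≈⟨ [1+X][1+X̄]≈s ⟩
        s                               ≈⟨ *-identityʳ s ⟨
        s * 1#                          ∎)) (sym s^m*s^m≈1))

-- Reduction modulo p of rationals with denominator prime to p

module Reduction {p : ℕ} (pr : Prime p) (F : ResidueField p) where

  open ResidueField F
  open Exp semiring
  open CommutativeExp commutativeSemiring using (^-distrib-*)
  open RingProperties ring
  open PrimeField pr F
  open Solver commutativeSemiring using (solve; _:=_; _:+_; _:*_; con)
  open import Relation.Binary.Reasoning.Setoid setoid

  ⟦-⟧ : ∀ a b → ⟦ a ℤ.- b ⟧ ≈ ⟦ a ⟧ - ⟦ b ⟧
  ⟦-⟧ a b = trans (+-homo a (ℤ.- b)) (+-congˡ (-‿homo b))

  ∣-⇒≈ : ∀ {a b} → p ℕ.∣ ∣ a ℤ.- b ∣ → ⟦ a ⟧ ≈ ⟦ b ⟧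
  ∣-⇒≈ {a} {b} p∣a-b = x∙y⁻¹≈ε⇒x≈y _ _ (trans (sym (⟦-⟧ a b)) (∣⇒⟦⟧≈0 p∣a-b))

  ≈⇒∣- : ∀ {a b} → ⟦ a ⟧ ≈ ⟦ b ⟧ → p ℕ.∣ ∣ a ℤ.- b ∣
  ≈⇒∣- {a} {b} a≈b = ⟦⟧≈0⇒∣ (trans (⟦-⟧ a b) (x≈y⇒x∙y⁻¹≈ε a≈b))

  -- A relation in cross-multiplied form: it needs no inverse of the denominator, and it is
  -- compatible with the cancellation that follows every rational operation.
  infix 4 _⇝_
  record _⇝_ (x : ℚ) (κ : Carrier) : Set where
    constructor reduces
    field
      integral-at-p : ¬ (p ∈𝒟 x)
      residue       : ⟦ ↥ x ⟧ ≈ κ * ⟦ ↧ x ⟧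
  open _⇝_ public

  ↧≉0 : ∀ {x} → ¬ (p ∈𝒟 x) → ¬ (⟦ ↧ x ⟧ ≈ 0#)
  ↧≉0 {x@record{}} = ∤⇒≉0

  -- n / d is normalised, so its numerator and denominator are those of a
  -- cross-multiplied fraction.
  /-⇝ : ∀ n d {κ} → ¬ (p ℕ.∣ suc d) → ⟦ n ⟧ ≈ κ * ⟦ + suc d ⟧ → n ℚ./ suc d ⇝ κ
  /-⇝ n d {κ} p∤d n≈κd with n ℚ./ suc d | ℚ.toℚᵘ-fromℚᵘ (mkℚᵘ n d)
  ... | x@(mkℚ a b coprime) | *≡* cross = reduces p∤b a≈κb
    where
    a≈κb : ⟦ a ⟧ ≈ κ * ⟦ + suc b ⟧
    a≈κb = *-cancelˡ-≉0 (∤⇒≉0 p∤d) (begin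
      ⟦ + suc d ⟧ * ⟦ a ⟧             ≈⟨ *-comm _ _ ⟩
      ⟦ a ⟧ * ⟦ + suc d ⟧             ≈⟨ *-homo _ _ ⟨
      ⟦ a ℤ.* + suc d ⟧               ≈⟨ ⟦⟧-cong cross ⟩
      ⟦ n ℤ.* + suc b ⟧               ≈⟨ *-homo _ _ ⟩
      ⟦ n ⟧ * ⟦ + suc b ⟧             ≈⟨ *-congʳ n≈κd ⟩
      κ * ⟦ + suc d ⟧ * ⟦ + suc b ⟧   ≈⟨ solve 3 (λ k d b → k :* d :* b := d :* (k :* b)) refl κ ⟦ + suc d ⟧ ⟦ + suc b ⟧ ⟩
      ⟦ + suc d ⟧ * (κ * ⟦ + suc b ⟧) ∎)
    p∤b : ¬ (p ℕ.∣ suc b)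
    -- If p divided the reduced denominator b, then a = κ b would vanish modulo p too, against
    -- coprimality.
    p∤b p∣b = contradiction (Coprimality.recompute coprime (⟦⟧≈0⇒∣ a≈0 , p∣b)) p≢1
      where
      a≈0 : ⟦ a ⟧ ≈ 0#
      a≈0 = trans a≈κb (trans (*-congˡ (∣⇒⟦⟧≈0 p∣b)) (zeroʳ κ))
      p≢1 : p ≢ 1
      p≢1 ≡.refl = ¬prime[1] pr

  p∤* : ∀ {a b} → ¬ (p ℕ.∣ a) → ¬ (p ℕ.∣ b) → ¬ (p ℕ.∣ a ℕ.* b)
  p∤* p∤a p∤b p∣ab = Sum⊎.[ p∤a , p∤b ] (euclidsLemma _ _ pr p∣ab)

  ⟦+*⟧ : ∀ a b → ⟦ + (a ℕ.* b) ⟧ ≈ ⟦ + a ⟧ * ⟦ + b ⟧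
  ⟦+*⟧ a b = trans (⟦⟧-cong (ℤ.pos-* a b)) (*-homo (+ a) (+ b))

  ⇝-+ : ∀ {x y κ μ} → x ⇝ κ → y ⇝ μ → x ℚ.+ y ⇝ κ + μ
  ⇝-+ {x@record{}} {y@record{}} {κ} {μ} (reduces p∤b a≈κb) (reduces p∤d c≈μd) =
    /-⇝ (↥ x ℤ.* ↧ y ℤ.+ ↥ y ℤ.* ↧ x) _ (p∤* p∤b p∤d) (begin
      ⟦ ↥ x ℤ.* ↧ y ℤ.+ ↥ y ℤ.* ↧ x ⟧             ≈⟨ trans (+-homo _ _) (+-cong (*-homo _ _) (*-homo _ _)) ⟩
      ⟦ ↥ x ⟧ * ⟦ ↧ y ⟧ + ⟦ ↥ y ⟧ * ⟦ ↧ x ⟧       ≈⟨ +-cong (*-congʳ a≈κb) (*-congʳ c≈μd) ⟩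
      κ * ⟦ ↧ x ⟧ * ⟦ ↧ y ⟧ + μ * ⟦ ↧ y ⟧ * ⟦ ↧ x ⟧
        ≈⟨ solve 4 (λ k m b d → k :* b :* d :+ m :* d :* b := (k :+ m) :* (b :* d)) refl κ μ ⟦ ↧ x ⟧ ⟦ ↧ y ⟧ ⟩
      (κ + μ) * (⟦ ↧ x ⟧ * ⟦ ↧ y ⟧)               ≈⟨ *-congˡ (⟦+*⟧ _ _) ⟨
      (κ + μ) * ⟦ + (↧ₙ x ℕ.* ↧ₙ y) ⟧             ∎)

  ⇝-* : ∀ {x y κ μ} → x ⇝ κ → y ⇝ μ → x ℚ.* y ⇝ κ * μ
  ⇝-* {x@record{}} {y@record{}} {κ} {μ} (reduces p∤b a≈κb) (reduces p∤d c≈μd) =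
    /-⇝ (↥ x ℤ.* ↥ y) _ (p∤* p∤b p∤d) (begin
      ⟦ ↥ x ℤ.* ↥ y ⟧                             ≈⟨ *-homo _ _ ⟩
      ⟦ ↥ x ⟧ * ⟦ ↥ y ⟧                           ≈⟨ *-cong a≈κb c≈μd ⟩
      κ * ⟦ ↧ x ⟧ * (μ * ⟦ ↧ y ⟧)
        ≈⟨ solve 4 (λ k m b d → k :* b :* (m :* d) := k :* m :* (b :* d)) refl κ μ ⟦ ↧ x ⟧ ⟦ ↧ y ⟧ ⟩
      κ * μ * (⟦ ↧ x ⟧ * ⟦ ↧ y ⟧)                 ≈⟨ *-congˡ (⟦+*⟧ _ _) ⟨
      κ * μ * ⟦ + (↧ₙ x ℕ.* ↧ₙ y) ⟧               ∎)

  ⇝-resp-≈ : ∀ {x κ μ} → κ ≈ μ → x ⇝ κ → x ⇝ μ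
  ⇝-resp-≈ κ≈μ (reduces p∤d a≈κb) = reduces p∤d (trans a≈κb (*-congʳ κ≈μ))

  ⇝-neg : ∀ {x κ} → x ⇝ κ → ℚ.- x ⇝ - κ
  ⇝-neg {x} {κ} (reduces p∤d a≈κb) = reduces
    (subst (λ d → ¬ (p ℕ.∣ ∣ d ∣)) (≡.sym (ℚ.↧-neg x)) p∤d) (begin
      ⟦ ↥ (ℚ.- x) ⟧          ≈⟨ ⟦⟧-cong (ℚ.↥-neg x) ⟩
      ⟦ ℤ.- (↥ x) ⟧          ≈⟨ -‿homo (↥ x) ⟩
      - ⟦ ↥ x ⟧              ≈⟨ -‿cong a≈κb ⟩
      - (κ * ⟦ ↧ x ⟧)        ≈⟨ -‿distribˡ-* κ _ ⟩
      - κ * ⟦ ↧ x ⟧          ≈⟨ *-congˡ (⟦⟧-cong (ℚ.↧-neg x)) ⟨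
      - κ * ⟦ ↧ (ℚ.- x) ⟧    ∎)

  ⇝-unique : ∀ {x κ μ} → x ⇝ κ → x ⇝ μ → κ ≈ μ
  ⇝-unique {x} (reduces p∤d a≈κb) (reduces _ a≈μb) =
    *-cancelˡ-≉0 (↧≉0 {x} p∤d) (trans (*-comm _ _) (trans (sym a≈κb) (trans a≈μb (*-comm _ _))))

  ⇝0⇒∣ : ∀ {x κ} → x ⇝ κ → κ ≈ 0# → p ℕ.∣ ∣ ↥ x ∣
  ⇝0⇒∣ (reduces _ a≈κb) κ≈0 = ⟦⟧≈0⇒∣ (trans a≈κb (trans (*-congʳ κ≈0) (zeroˡ _)))

  ∣⇒⇝0 : ∀ {x κ} → x ⇝ κ → p ℕ.∣ ∣ ↥ x ∣ → κ ≈ 0#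
  ∣⇒⇝0 {x} (reduces p∤d a≈κb) p∣a with integral (trans (sym a≈κb) (∣⇒⟦⟧≈0 p∣a))
  ... | inj₁ κ≈0 = κ≈0
  ... | inj₂ d≈0 = contradiction d≈0 (↧≉0 {x} p∤d)

  ⇝⇒≡modℚ : ∀ {x y κ} → x ⇝ κ → y ⇝ κ → x ≡ y [modℚ p ]
  ⇝⇒≡modℚ {κ = κ} x⇝κ y⇝κ = ⇝0⇒∣ (⇝-+ x⇝κ (⇝-neg y⇝κ)) (-‿inverseʳ κ)

  p∤1 : ¬ (p ℕ.∣ 1)
  p∤1 p∣1 = 1≉0 (trans (sym 1#-homo) (∣⇒⟦⟧≈0 p∣1))

  ℤ→ℚ-⇝ : ∀ z → ℤ→ℚ z ⇝ ⟦ z ⟧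
  ℤ→ℚ-⇝ z = /-⇝ z 0 p∤1 (trans (sym (*-identityʳ _)) (*-congˡ (sym 1#-homo)))

  -- Euler's criterion for the Legendre symbol of a rational

  module Legendre {n : ℕ} (p≡1+m+m : p ≡ suc (suc n ℕ.+ suc n)) where

    open Odd p≡1+m+m

    -- The double of m + 1 is p + 1, which is 1 modulo p.
    ½-⇝ : ½ ⇝ ⟦ + suc m ⟧
    ½-⇝ = reduces p∤2 (begin
      ⟦ + 1 ⟧                               ≈⟨ +-identityʳ _ ⟨
      ⟦ + 1 ⟧ + 0#                          ≈⟨ +-congˡ (∣⇒⟦⟧≈0 (ℕ.∣-refl {p})) ⟨
      ⟦ + 1 ⟧ + ⟦ + p ⟧                     ≈⟨ +-homo _ _ ⟨
      ⟦ + suc p ⟧                           ≈⟨ ⟦⟧-cong (cong +_ (≡.trans (cong suc p≡1+m+m) (double m))) ⟩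
      ⟦ + (suc m ℕ.* 2) ⟧                   ≈⟨ ⟦+*⟧ _ _ ⟩
      ⟦ + suc m ⟧ * ⟦ + 2 ⟧                 ∎)
      where
      double : ∀ k → suc (suc (k ℕ.+ k)) ≡ suc k ℕ.* 2
      double = ℕ-Solver.solve-∀
      p∤2 : ¬ (p ℕ.∣ 2)
      p∤2 p∣2 = ℕ.<⇒≱ (ℕ.≤-<-trans (ℕ.+-mono-≤ {1} {m} (ℕ.s≤s ℕ.z≤n) (ℕ.s≤s ℕ.z≤n)) m+m<p) (ℕ.∣⇒≤ p∣2)

    -- By Fermat the inverse is the power with exponent p - 2 = n + m.
    inverse : ∀ {x} → ¬ (x ≈ 0#) → ∃ λ y → y * x ≈ 1#
    inverse {x} x≉0 = x ^ (n ℕ.+ m) , trans (*-comm _ x) (≉0⇒^[m+m]≈1 x≉0)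

    reduce : ∀ x → ¬ (p ∈𝒟 x) → ∃ λ κ → x ⇝ κ
    reduce x p∤d with inverse (↧≉0 {x} p∤d)
    ... | y , yd≈1 = ⟦ ↥ x ⟧ * y , reduces p∤d (begin
      ⟦ ↥ x ⟧                    ≈⟨ *-identityʳ _ ⟨
      ⟦ ↥ x ⟧ * 1#               ≈⟨ *-congˡ yd≈1 ⟨
      ⟦ ↥ x ⟧ * (y * ⟦ ↧ x ⟧)    ≈⟨ *-assoc _ _ _ ⟨
      ⟦ ↥ x ⟧ * y * ⟦ ↧ x ⟧      ∎)

    -- From a = κ b follows a b = κ b², and squares of nonzero elements have m-th power 1. This
    -- justifies testing a b in place of a / b.
    [↥*↧]^m≈κ^m : ∀ {x κ} → x ⇝ κ → ⟦ ↥ x ℤ.* ↧ x ⟧ ^ m ≈ κ ^ m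
    [↥*↧]^m≈κ^m {x} {κ} (reduces p∤d a≈κb) = begin
      ⟦ ↥ x ℤ.* ↧ x ⟧ ^ m                    ≈⟨ ^-congˡ m (trans (*-homo _ _) (trans (*-congʳ a≈κb) (*-assoc _ _ _))) ⟩
      (κ * (⟦ ↧ x ⟧ * ⟦ ↧ x ⟧)) ^ m          ≈⟨ ^-distrib-* κ _ m ⟩
      κ ^ m * (⟦ ↧ x ⟧ * ⟦ ↧ x ⟧) ^ m        ≈⟨ *-congˡ ([x*x]^m≈1 (↧≉0 {x} p∤d)) ⟩
      κ ^ m * 1#                             ≈⟨ *-identityʳ _ ⟩
      κ ^ m                                  ∎

    -- If a b is a nonzero square t², its m-th power is 1 by Fermat. If the search fails, the value
    -- 1 is excluded, because `^m≈1⇒square` would supply a root within the searched range; so the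
    -- value is -1.
    euler-criterion : ∀ {x κ} → x ⇝ κ → ⟦ legendre x p ⟧ ≈ κ ^ m
    euler-criterion {x} {κ} x⇝κ
      -- These are the two tests on which `legendre` branches, so it evaluates to 0, 1 or -1 in the
      -- cases below.
      with p ℕ.∣? ∣ ↥ x ∣ | any? (λ t → p ℕ.∣? ∣ (+ t) ℤ.* (+ t) ℤ.- (↥ x ℤ.* + (↧ₙ x)) ∣) (upTo p)
    ... | yes p∣a | _ = trans 0#-homo (sym (0^m≈0 (∣⇒⇝0 x⇝κ p∣a)))
    ... | no p∤a | yes square with satisfied square
    ...   | t , p∣t²-ab = begin
      ⟦ 1ℤ ⟧                       ≈⟨ 1#-homo ⟩
      1#                           ≈⟨ [x*x]^m≈1 t≉0 ⟨
      (⟦ + t ⟧ * ⟦ + t ⟧) ^ m      ≈⟨ ^-congˡ m t²≈ab ⟩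
      ⟦ ↥ x ℤ.* ↧ x ⟧ ^ m          ≈⟨ [↥*↧]^m≈κ^m x⇝κ ⟩
      κ ^ m                        ∎
      where
      t²≈ab : ⟦ + t ⟧ * ⟦ + t ⟧ ≈ ⟦ ↥ x ℤ.* ↧ x ⟧
      t²≈ab = trans (sym (*-homo _ _)) (∣-⇒≈ p∣t²-ab)
      t≉0 : ¬ (⟦ + t ⟧ ≈ 0#)
      t≉0 t≈0 = *-≉0 (∤⇒≉0 {↥ x} p∤a) (↧≉0 {x} (integral-at-p x⇝κ))
        (trans (sym (*-homo (↥ x) (↧ x))) (trans (sym t²≈ab) (trans (*-congʳ t≈0) (zeroˡ _))))
    euler-criterion {x} {κ} x⇝κ | no p∤a | no nonsquare
      with ^m≈±1 (*-≉0 (∤⇒≉0 {↥ x} p∤a) (↧≉0 {x} (integral-at-p x⇝κ)))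
    ... | inj₁ ab^m≈1 with ^m≈1⇒square ab^m≈1
    ...   | t , t<p , ab≈t² = contradiction
      (lose (∈-upTo⁺ t<p) (≈⇒∣- (trans (*-homo _ _) (trans (sym ab≈t²) (sym (*-homo _ _)))))) nonsquare
    euler-criterion {x} {κ} x⇝κ | no p∤a | no nonsquare
        | inj₂ ab^m≈-1 = begin
      ⟦ -1ℤ ⟧                      ≈⟨ trans (-‿homo 1ℤ) (-‿cong 1#-homo) ⟩
      - 1#                         ≈⟨ ab^m≈-1 ⟨
      (⟦ ↥ x ⟧ * ⟦ ↧ x ⟧) ^ m      ≈⟨ ^-congˡ m (*-homo _ _) ⟨
      ⟦ ↥ x ℤ.* ↧ x ⟧ ^ m          ≈⟨ [↥*↧]^m≈κ^m x⇝κ ⟩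
      κ ^ m                        ∎

-- Values of the Legendre symbol, and the form of an odd prime

-- Links the value of the symbol to divisibility of the numerator, by which a case of the theorem
-- becomes δ = 0 or δ ≠ 0 in the residue field.
legendre-values : ∀ x p → (legendre x p ≡ + 0 × p ℕ.∣ ∣ ↥ x ∣) ⊎
  ((legendre x p ≡ + 1 ⊎ legendre x p ≡ -[1+ 0 ]) × ¬ (p ℕ.∣ ∣ ↥ x ∣))
legendre-values x p
  with p ℕ.∣? ∣ ↥ x ∣ | any? (λ t → p ℕ.∣? ∣ (+ t) ℤ.* (+ t) ℤ.- (↥ x ℤ.* + (↧ₙ x)) ∣) (upTo p)
... | yes p∣a | _     = inj₁ (≡.refl , p∣a)
... | no p∤a  | yes _ = inj₂ (inj₁ ≡.refl , p∤a)
... | no p∤a  | no _  = inj₂ (inj₂ ≡.refl , p∤a)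

odd-prime : ∀ {p} → Prime p → ¬ (2 ℕ.∣ p) → ∃ λ n → p ≡ suc (suc n ℕ.+ suc n)
odd-prime {p} pr 2∤p with p % 2 in r | p / 2 in k | ℕ.m≡m%n+[m/n]*n p 2 | ℕ.m%n<n p 2
... | 0             | _      | _      | _ = contradiction (ℕ.m%n≡0⇒n∣m p 2 r) 2∤p
-- A zero quotient would mean p = 1; hence (p - 1) / 2 is a successor.
... | 1             | zero   | ≡.refl | _ = contradiction pr ¬prime[1]
... | 1             | suc n  | p≡     | _ = n , ≡.trans p≡ (double n)
  where
  double : ∀ n → 1 ℕ.+ suc n ℕ.* 2 ≡ suc (suc n ℕ.+ suc n)
  double = ℕ-Solver.solve-∀
... | suc (suc _)   | _      | _      | ℕ.s≤s (ℕ.s≤s ())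

-- Powers of the matrix as powers of X

module PowersModP {p : ℕ} (pr : Prime p) (F : ResidueField p) {n : ℕ}
  (p≡1+m+m : p ≡ suc (suc n ℕ.+ suc n)) where

  open ResidueField F hiding (zero)
  open Exp semiring
  open RingProperties ring
  open Solver commutativeSemiring using (solve; _:=_; _:+_; _:*_; con)
  open PrimeField pr F
  open Odd p≡1+m+m
  open Reduction pr F
  open Legendre p≡1+m+m
  open import Relation.Binary.Reasoning.Setoid setoid

  ⟦2⟧≈ : ⟦ + 2 ⟧ ≈ 1# + 1#
  ⟦2⟧≈ = trans (sym (×1≈⟦⟧ 2)) (+-congˡ (+-identityʳ 1#))

  ⟦4⟧≈ : ⟦ + 4 ⟧ ≈ 1# + 1# + 1# + 1#
  ⟦4⟧≈ = trans (sym (×1≈⟦⟧ 4)) (solve 1 (λ x → x :+ (x :+ (x :+ (x :+ con 0))) := x :+ x :+ x :+ x) refl 1#)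

  1ℚ-⇝ : 1ℚ ⇝ 1#
  1ℚ-⇝ = ⇝-resp-≈ 1#-homo (ℤ→ℚ-⇝ 1ℤ)

  0ℚ-⇝ : ℚ.0ℚ ⇝ 0#
  0ℚ-⇝ = ⇝-resp-≈ 0#-homo (ℤ→ℚ-⇝ 0ℤ)

  scal-cong : ∀ {x y κ} → x ⇝ κ → y ⇝ κ → scal x ≡ᴹ scal y [mod p ]
  scal-cong x⇝κ y⇝κ 0F 0F = ⇝⇒≡modℚ x⇝κ y⇝κ
  scal-cong x⇝κ y⇝κ 1F 1F = ⇝⇒≡modℚ x⇝κ y⇝κ
  scal-cong x⇝κ y⇝κ 0F 1F = ⇝⇒≡modℚ 0ℚ-⇝ 0ℚ-⇝
  scal-cong x⇝κ y⇝κ 1F 0F = ⇝⇒≡modℚ 0ℚ-⇝ 0ℚ-⇝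

  module _ (A : Mat2) (q : ℚ) (det≡1 : det A ≡ 1ℚ) (tr≡q : tr A ≡ q)
    (integral-A : ∀ i j → ¬ (p ∈𝒟 A i j)) where

    Δ : ℚ
    Δ = q ℚ.* q ℚ.- ℤ→ℚ (+ 4)

    α : Fin 2 → Fin 2 → Carrier
    α i j = proj₁ (reduce (A i j) (integral-A i j))

    A⇝α : ∀ i j → A i j ⇝ α i j
    A⇝α i j = proj₂ (reduce (A i j) (integral-A i j))

    private
      a b c d τ δ σ h : Carrier
      a = α 0F 0F
      b = α 0F 1F
      c = α 1F 0F
      d = α 1F 1F
      τ = a + d
      δ = τ * τ - ⟦ + 4 ⟧
      σ = τ + ⟦ + 2 ⟧
      h = ⟦ + suc m ⟧

    q⇝τ : q ⇝ τ
    q⇝τ = subst (_⇝ τ) tr≡q (⇝-+ (A⇝α _ _) (A⇝α _ _))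

    δ-⇝ : Δ ⇝ δ
    δ-⇝ = ⇝-+ (⇝-* q⇝τ q⇝τ) (⇝-neg (ℤ→ℚ-⇝ (+ 4)))

    σ-⇝ : q ℚ.+ ℤ→ℚ (+ 2) ⇝ σ
    σ-⇝ = ⇝-+ q⇝τ (ℤ→ℚ-⇝ (+ 2))

    h+h≈1 : h + h ≈ 1#
    -- The rational sum of `½` and `½` evaluates to `1ℚ`, so both sides are residues of one number.
    h+h≈1 = ⇝-unique (⇝-+ ½-⇝ ½-⇝) 1ℚ-⇝

    -- The determinant condition, solved for the product that has to be eliminated in the diagonal
    -- entries of A².
    bc≈ad-1 : b * c ≈ a * d - 1#
    bc≈ad-1 = x≈z//y _ _ _ (begin
      b * c + 1#                     ≈⟨ +-congˡ det≈1 ⟨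
      b * c + (a * d - b * c)        ≈⟨ solve 3 (λ x y z → x :+ (y :+ z) := y :+ (x :+ z)) refl (b * c) (a * d) (- (b * c)) ⟩
      a * d + (b * c - b * c)        ≈⟨ +-congˡ (-‿inverseʳ (b * c)) ⟩
      a * d + 0#                     ≈⟨ +-identityʳ _ ⟩
      a * d                          ∎)
      where
      det≈1 : a * d - b * c ≈ 1#
      det≈1 = ⇝-unique (subst (_⇝ a * d - b * c) det≡1 (⇝-+ (⇝-* (A⇝α _ _) (A⇝α _ _)) (⇝-neg (⇝-* (A⇝α _ _) (A⇝α _ _))))) 1ℚ-⇝

    open QuadraticExtension commutativeRing τ (- 1#)
      using (X; constant; constant-cong; constant-+; constant-*; constant-^)
      renaming (commutativeRing to 𝓡; annihilates to 𝓡-annihilates)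
    private
      module R = CommutativeRing 𝓡
      module RExp = Exp R.semiring
      module RProp = RingProperties R.ring

    -- The matrix x I + y A modulo p.
    entry : R.Carrier → Fin 2 → Fin 2 → Carrier
    entry (x , y) 0F 0F = x + y * a
    entry (x , y) 0F 1F = y * b
    entry (x , y) 1F 0F = y * c
    entry (x , y) 1F 1F = x + y * d

    entry-cong : ∀ {y z} → y R.≈ z → ∀ i j → entry y i j ≈ entry z i j
    entry-cong (e , f) 0F 0F = +-cong e (*-congʳ f)
    entry-cong (e , f) 0F 1F = *-congʳ f
    entry-cong (e , f) 1F 0F = *-congʳ f
    entry-cong (e , f) 1F 1F = +-cong e (*-congʳ f)

    scal-⇝ : ∀ {x κ} → x ⇝ κ → ∀ i j → scal x i j ⇝ entry (constant κ) i j
    scal-⇝ x⇝κ 0F 0F = ⇝-resp-≈ (sym (trans (+-congˡ (zeroˡ a)) (+-identityʳ _))) x⇝κ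
    scal-⇝ x⇝κ 0F 1F = ⇝-resp-≈ (sym (zeroˡ b)) 0ℚ-⇝
    scal-⇝ x⇝κ 1F 0F = ⇝-resp-≈ (sym (zeroˡ c)) 0ℚ-⇝
    scal-⇝ x⇝κ 1F 1F = ⇝-resp-≈ (sym (trans (+-congˡ (zeroˡ d)) (+-identityʳ _))) x⇝κ

    -- Cayley-Hamilton for a 2 × 2 matrix of determinant 1: multiplication by A acts on x I + y A as
    -- X acts on x + y X. The determinant enters only on the diagonal.
    entry-X* : ∀ z i j → α i 0F * entry z 0F j + α i 1F * entry z 1F j ≈ entry (X R.* z) i j
    entry-X* (x , y) 0F 0F = begin
      a * (x + y * a) + b * (y * c)
        ≈⟨ solve 5 (λ a b c x y → a :* (x :+ y :* a) :+ b :* (y :* c)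
             := x :* a :+ y :* a :* a :+ y :* (b :* c)) refl a b c x y ⟩
      x * a + y * a * a + y * (b * c)
        ≈⟨ +-congˡ (*-congˡ bc≈ad-1) ⟩
      x * a + y * a * a + y * (a * d - 1#)
        ≈⟨ solve 5 (λ a d r x y → x :* a :+ y :* a :* a :+ y :* (a :* d :+ r)
             := con 0 :* x :+ r :* (con 1 :* y) :+ (con 0 :* y :+ con 1 :* x :+ (a :+ d) :* (con 1 :* y)) :* a)
             refl a d (- 1#) x y ⟩
      entry (X R.* (x , y)) 0F 0F ∎
    entry-X* (x , y) 0F 1F =
      solve 5 (λ a b d x y → a :* (y :* b) :+ b :* (x :+ y :* d)
        := (con 0 :* y :+ con 1 :* x :+ (a :+ d) :* (con 1 :* y)) :* b) refl a b d x y
    entry-X* (x , y) 1F 0F =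
      solve 5 (λ a c d x y → c :* (x :+ y :* a) :+ d :* (y :* c)
        := (con 0 :* y :+ con 1 :* x :+ (a :+ d) :* (con 1 :* y)) :* c) refl a c d x y
    entry-X* (x , y) 1F 1F = begin
      c * (y * b) + d * (x + y * d)
        ≈⟨ solve 5 (λ b c d x y → c :* (y :* b) :+ d :* (x :+ y :* d)
             := x :* d :+ y :* d :* d :+ y :* (b :* c)) refl b c d x y ⟩
      x * d + y * d * d + y * (b * c)
        ≈⟨ +-congˡ (*-congˡ bc≈ad-1) ⟩
      x * d + y * d * d + y * (a * d - 1#)
        ≈⟨ solve 5 (λ a d r x y → x :* d :+ y :* d :* d :+ y :* (a :* d :+ r)
             := con 0 :* x :+ r :* (con 1 :* y) :+ (con 0 :* y :+ con 1 :* x :+ (a :+ d) :* (con 1 :* y)) :* d)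
             refl a d (- 1#) x y ⟩
      entry (X R.* (x , y)) 1F 1F ∎

    ^ᴹ-⇝ : ∀ k i j → (A ^ᴹ k) i j ⇝ entry (X RExp.^ k) i j
    ^ᴹ-⇝ zero    i j = scal-⇝ 1ℚ-⇝ i j
    ^ᴹ-⇝ (suc k) i j = ⇝-resp-≈ (entry-X* (X RExp.^ k) i j)
      (⇝-+ (⇝-* (A⇝α i 0F) (^ᴹ-⇝ k 0F j)) (⇝-* (A⇝α i 1F) (^ᴹ-⇝ k 1F j)))

    ^ᴹ-scalar : ∀ k {x κ} → X RExp.^ k R.≈ constant κ → x ⇝ κ → A ^ᴹ k ≡ᴹ scal x [mod p ]
    ^ᴹ-scalar k X^k≈κ x⇝κ i j =
      ⇝⇒≡modℚ (⇝-resp-≈ (entry-cong X^k≈κ i j) (^ᴹ-⇝ k i j)) (scal-⇝ x⇝κ i j)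

    X̄ w : R.Carrier
    X̄ = τ , - 1#
    w = X R.- X̄

    XX̄≈1 : X R.* X̄ R.≈ R.1#
    XX̄≈1 =
      (begin
        0# * τ + - 1# * (1# * - 1#)         ≈⟨ +-cong (zeroˡ τ) (trans (-1*x≈-x _) (-‿cong (*-identityˡ _))) ⟩
        0# + - - 1#                         ≈⟨ trans (+-identityˡ _) (-‿involutive 1#) ⟩
        1#                                  ∎) ,
      (begin
        0# * - 1# + 1# * τ + τ * (1# * - 1#)   ≈⟨ solve 2 (λ t r → con 0 :* r :+ con 1 :* t :+ t :* (con 1 :* r) := t :* (con 1 :+ r)) refl τ (- 1#) ⟩
        τ * (1# - 1#)                          ≈⟨ *-congˡ (-‿inverseʳ 1#) ⟩
        τ * 0#                                 ≈⟨ zeroʳ τ ⟩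
        0#                                     ∎)

    X+X̄≈τ : X R.+ X̄ R.≈ constant τ
    X+X̄≈τ = +-identityˡ τ , -‿inverseʳ 1#

    w+X̄≈X : w R.+ X̄ R.≈ X
    w+X̄≈X = R.trans (R.+-assoc X (R.- X̄) X̄) (R.trans (R.+-congˡ (R.-‿inverseˡ X̄)) (R.+-identityʳ X))

    constant-h : constant h R.+ constant h R.≈ R.1#
    constant-h = R.trans (R.sym (constant-+ h h)) (constant-cong h+h≈1)

    -- The sum is the scalar τ, an element of the prime field, so Fermat applies.
    trace^p : (X R.+ X̄) RExp.^ p R.≈ X R.+ X̄
    trace^p = R.trans (RExp.^-congˡ p X+X̄≈τ) (R.trans (R.sym (constant-^ τ p))
      (R.trans (constant-cong (fermat τ)) (R.sym X+X̄≈τ)))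

    open Halving 𝓡 pr (𝓡-annihilates {p} char) {m} p≡1+m+m
    open Conjugates XX̄≈1 w+X̄≈X constant-h trace^p

    w*w≈δ : w R.* w R.≈ constant δ
    w*w≈δ = RProp.+-cancelʳ 4R _ _ (R.trans w*w+4≈q*q (R.trans (R.*-cong X+X̄≈τ X+X̄≈τ)
      (R.trans (R.sym (constant-* τ τ)) (R.sym (trans (+-congˡ (sym ⟦4⟧≈)) (//-rightDividesˡ ⟦ + 4 ⟧ (τ * τ)) , zeros)))))
      where
      4R : R.Carrier
      4R = R.1# R.+ R.1# R.+ R.1# R.+ R.1#
      zeros : 0# + (0# + 0# + 0# + 0#) ≈ 0#
      zeros = solve 0 (con 0 :+ (con 0 :+ con 0 :+ con 0 :+ con 0) := con 0) refl

    [w*w]^m≈ : ∀ {ε} → δ ^ m ≈ ε → (w R.* w) RExp.^ m R.≈ constant ε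
    [w*w]^m≈ δ^m≈ε = R.trans (RExp.^-congˡ m w*w≈δ) (R.trans (R.sym (constant-^ δ m)) (constant-cong δ^m≈ε))

    s≈σ : X R.+ X̄ R.+ (R.1# R.+ R.1#) R.≈ constant σ
    s≈σ = R.trans (R.+-congʳ X+X̄≈τ) (+-congˡ (sym ⟦2⟧≈) , trans (+-identityˡ _) (+-identityˡ 0#))

    s^m≈σ^m : (X R.+ X̄ R.+ (R.1# R.+ R.1#)) RExp.^ m R.≈ constant (σ ^ m)
    s^m≈σ^m = R.trans (RExp.^-congˡ m s≈σ) (R.sym (constant-^ σ m))

    -- If τ were -2, then τ² would be 4.
    δ≉0⇒σ≉0 : ¬ (δ ≈ 0#) → ¬ (σ ≈ 0#)
    δ≉0⇒σ≉0 δ≉0 σ≈0 = δ≉0 (x≈y⇒x∙y⁻¹≈ε (begin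
      τ * τ                      ≈⟨ *-cong τ≈-2 τ≈-2 ⟩
      - ⟦ + 2 ⟧ * - ⟦ + 2 ⟧      ≈⟨ *-cong (-‿homo (+ 2)) (-‿homo (+ 2)) ⟨
      ⟦ -[1+ 1 ] ⟧ * ⟦ -[1+ 1 ] ⟧  ≈⟨ *-homo -[1+ 1 ] -[1+ 1 ] ⟨
      ⟦ + 4 ⟧                    ∎))
      where
      τ≈-2 : τ ≈ - ⟦ + 2 ⟧
      τ≈-2 = +-inverseˡ-unique _ _ σ≈0

    module Nondegenerate (δ≉0 : ¬ (δ ≈ 0#)) where

      σ≉0 : ¬ (σ ≈ 0#)
      σ≉0 = δ≉0⇒σ≉0 δ≉0

      -- The inverse of s is the scalar inverse of σ, and the square of sᵐ is the scalar σ to the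
      -- power p - 1, which is 1.
      open Half {constant (proj₁ (inverse σ≉0))}
        (R.trans (R.*-congˡ s≈σ) (R.trans (R.sym (constant-* _ σ)) (constant-cong (proj₂ (inverse σ≉0)))))
        (R.trans (R.*-cong s^m≈σ^m s^m≈σ^m) (R.trans (R.sym (constant-* _ _))
          (constant-cong (trans (sym (^-homo-* σ m m)) (≉0⇒^[m+m]≈1 σ≉0)))))

      split : δ ^ m ≈ 1# → X RExp.^ m R.≈ constant (σ ^ m)
      split δ^m≈1 = R.trans (split⇒X^m≈s^m (split⇒X^p≈X ([w*w]^m≈ δ^m≈1))) s^m≈σ^m

      inert : δ ^ m ≈ - 1# → X RExp.^ suc m R.≈ constant (σ ^ m)
      inert δ^m≈-1 = R.trans (inert⇒X^[1+m]≈s^m (inert⇒X^p≈X̄ (R.trans ([w*w]^m≈ δ^m≈-1) constant--1))) s^m≈σ^m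
        where
        constant--1 : constant (- 1#) R.≈ R.- R.1#
        constant--1 = refl , sym -0#≈0#

    ramified : δ ≈ 0# → X RExp.^ p R.≈ constant (τ * h)
    ramified δ≈0 = R.trans (ramified⇒X^p≈q/2 ([w*w]^m≈ (0^m≈0 δ≈0)))
      (R.trans (R.*-congʳ X+X̄≈τ) (R.sym (constant-* τ h)))

    -- When τ² = 4, half of τ has square 1; this yields the sign in the degenerate case.
    [τh]²≈1 : δ ≈ 0# → τ * h * (τ * h) ≈ 1#
    [τh]²≈1 δ≈0 = begin
      τ * h * (τ * h)                        ≈⟨ solve 2 (λ t h → t :* h :* (t :* h) := t :* t :* (h :* h)) refl τ h ⟩
      τ * τ * (h * h)                        ≈⟨ *-congʳ (trans (x∙y⁻¹≈ε⇒x≈y _ _ δ≈0) ⟦4⟧≈) ⟩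
      (1# + 1# + 1# + 1#) * (h * h)          ≈⟨ solve 1 (λ h → (con 1 :+ con 1 :+ con 1 :+ con 1) :* (h :* h) := (h :+ h) :* (h :+ h)) refl h ⟩
      (h + h) * (h + h)                      ≈⟨ *-cong h+h≈1 h+h≈1 ⟩
      1# * 1#                                ≈⟨ *-identityˡ 1# ⟩
      1#                                     ∎

    -- Return to Legendre symbols and matrix congruences

    legendre-σ : ℤ→ℚ (legendre (q ℚ.+ ℤ→ℚ (+ 2)) p) ⇝ σ ^ m
    legendre-σ = ⇝-resp-≈ (euler-criterion σ-⇝) (ℤ→ℚ-⇝ _)

    -- Makes the truncating division in the exponent exact once p - ε is exhibited as twice k.
    ^ᴹ-scalar-half : ∀ ε k {x κ} → ∣ + p ℤ.- ε ∣ ≡ k ℕ.* 2 → X RExp.^ k R.≈ constant κ → x ⇝ κ →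
      A ^ᴹ (∣ + p ℤ.- ε ∣ / 2) ≡ᴹ scal x [mod p ]
    ^ᴹ-scalar-half ε k {x} p-ε≡k*2 X^k≈κ x⇝κ =
      subst (λ e → A ^ᴹ (e / 2) ≡ᴹ scal x [mod p ]) (≡.sym p-ε≡k*2)
        (subst (λ e → A ^ᴹ e ≡ᴹ scal x [mod p ]) (≡.sym (ℕ.m*n/n≡m k 2)) (^ᴹ-scalar k X^k≈κ x⇝κ))

    nondegenerate : legendre Δ p ≢ + 0 →
      A ^ᴹ (∣ + p ℤ.- legendre Δ p ∣ / 2)
        ≡ᴹ scal (ℤ→ℚ (legendre (q ℚ.+ ℤ→ℚ (+ 2)) p)) [mod p ]
    nondegenerate ≢0 with legendre-values Δ p
    ... | inj₁ (≡0 , _) = contradiction ≡0 ≢0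
    ... | inj₂ (inj₁ ≡1 , p∤δ) = ^ᴹ-scalar-half (legendre Δ p) m
      (≡.trans (≡.cong₂ (λ p ε → ∣ + p ℤ.- ε ∣) p≡1+m+m ≡1) (double m))
      (split (trans (sym (euler-criterion δ-⇝)) (trans (⟦⟧-cong ≡1) 1#-homo)))
      legendre-σ
      where
      open Nondegenerate (λ δ≈0 → p∤δ (⇝0⇒∣ δ-⇝ δ≈0))
      double : ∀ m → m ℕ.+ m ≡ m ℕ.* 2
      double = ℕ-Solver.solve-∀
    -- Now p - (-1) = 2 (m + 1), in place of p - 1 = 2 m.
    ... | inj₂ (inj₂ ≡-1 , p∤δ) = ^ᴹ-scalar-half (legendre Δ p) (suc m)
      (≡.trans (≡.cong₂ (λ p ε → ∣ + p ℤ.- ε ∣) p≡1+m+m ≡-1) (double m))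
      (inert (trans (sym (euler-criterion δ-⇝)) (trans (⟦⟧-cong ≡-1) (trans (-‿homo 1ℤ) (-‿cong 1#-homo)))))
      legendre-σ
      where
      open Nondegenerate (λ δ≈0 → p∤δ (⇝0⇒∣ δ-⇝ δ≈0))
      double : ∀ m → suc (m ℕ.+ m) ℕ.+ 1 ≡ suc m ℕ.* 2
      double = ℕ-Solver.solve-∀

    degenerate : legendre Δ p ≡ + 0 →
      (A ^ᴹ p ≡ᴹ scal (q ℚ.* ½) [mod p ]) ×
      ((scal (q ℚ.* ½) ≡ᴹ I₂ [mod p ]) ⊎ (scal (q ℚ.* ½) ≡ᴹ scal (ℚ.- 1ℚ) [mod p ]))
    degenerate ≡0 with legendre-values Δ p
    ... | inj₁ (_ , p∣δ) =
      ^ᴹ-scalar p (ramified δ≈0) q/2-⇝ ,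
      Sum⊎.map (λ τh≈1 → scal-cong (⇝-resp-≈ τh≈1 q/2-⇝) 1ℚ-⇝)
              (λ τh≈-1 → scal-cong (⇝-resp-≈ τh≈-1 q/2-⇝) (⇝-neg 1ℚ-⇝))
              (*≈1⇒±1 ([τh]²≈1 δ≈0))
      where
      δ≈0 : δ ≈ 0#
      δ≈0 = ∣⇒⇝0 δ-⇝ p∣δ
      q/2-⇝ : q ℚ.* ½ ⇝ τ * h
      q/2-⇝ = ⇝-* q⇝τ ½-⇝
    ... | inj₂ (inj₁ ≡1 , _)  with () ← ≡.trans (≡.sym ≡0) ≡1
    ... | inj₂ (inj₂ ≡-1 , _) with () ← ≡.trans (≡.sym ≡0) ≡-1

theorem8 : (A : Mat2) (q : ℚ) (p : ℕ) →
    det A ≡ 1ℚ → tr A ≡ q →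
    Prime p → ¬ (2 ∣ p) → ¬ (p ∈𝒟 q) →
    (∀ i j → ¬ (p ∈𝒟 A i j)) →
    let δ = q ℚ.* q ℚ.- ℤ→ℚ (+ 4) in
    (legendre δ p ≢ + 0 →
    A ^ᴹ (∣ + p ℤ.- legendre δ p ∣ / 2)
    ≡ᴹ scal (ℤ→ℚ (legendre (q ℚ.+ ℤ→ℚ (+ 2)) p)) [mod p ])
    × (legendre δ p ≡ + 0 →
    (A ^ᴹ p ≡ᴹ scal (q ℚ.* ½) [mod p ])
    × ((scal (q ℚ.* ½) ≡ᴹ I₂ [mod p ]) ⊎ (scal (q ℚ.* ½) ≡ᴹ scal (ℚ.- 1ℚ) [mod p ])))
theorem8 A q p det≡1 tr≡q pr 2∤p _ integral-A with odd-prime pr 2∤p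
... | n , p≡1+m+m = nondegenerate A q det≡1 tr≡q integral-A , degenerate A q det≡1 tr≡q integral-A
  where open PowersModP pr (residueField p) p≡1+m+m
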